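{- Let $p>3$ be a prime. Then $$\sum_{k=0}^{(p-1)/2}\frac{20k+3}{(-2^{10})^k}\binom{4k}{k,k,k,k}\equiv p\left(\frac{ -1}{p}\right)\left(2^{p-1}+2-(2^{p-1}-1)^2\right)\pmod{p^4},$$ where $\left(\frac{\cdot}{p}\right)$ is the Legendre symbol.
   Context: For each nonnegative integer $k$, $\binom{4k}{k,k,k,k}=\frac{(4k)!}{(k!)^4}=\binom{4k}{2k}\binom{2k}{k}^2$. For rational numbers $a,b$ whose denominators are prime to $p$, $a\equiv b\pmod{p^m}$ means that $a-b$ is $p^m$ times a rational number with denominator prime to $p$. One has $\left(\frac{ -1}{p}\right)=(-1)^{(p-1)/2}$. -}

module Defs where

open import Data.Bool.Base using (if_then_else_)
open import Data.Fin.Base using (toℕ)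
open import Data.Fin.Properties using (any?)
open import Data.Integer.Base as ℤ using (ℤ; +_; -1ℤ; 0ℤ; 1ℤ)
import Data.Integer.Properties as ℤ
open import Data.Integer.Divisibility.Signed using (_∣?_)
open import Data.Nat.Base as ℕ using (ℕ; zero; suc; _!)
open import Data.Nat.Coprimality using (Coprime)
import Data.Nat.Properties as ℕ
open import Data.Product.Base using (∃; _×_)
open import Data.Rational.Base using (ℚ; ↧ₙ_; _-_; _*_; _/_; _÷_)
open import Data.Rational.Literals using (fromℤ)
open import Relation.Binary.PropositionalEquality.Core using (_≡_)
open import Relation.Nullary.Decidable.Core using (does)

-- Meaningful when p is an odd prime.
legendre : ℤ → ℕ → ℤ
legendre a p =
  if does (+ p ∣? a) then 0ℤ else
  if does (any? {n = p} λ x → + p ∣? (+ toℕ x) ℤ.^ 2 ℤ.- a) then 1ℤ else -1ℤ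

-- The multinomial coefficient (4k; k, k, k, k), as an exact quotient in ℚ.
multinomial₄ : ℕ → ℚ
multinomial₄ k = + ((4 ℕ.* k) !) / ((k !) ℕ.^ 4)
  where instance _ = ℕ.m^n≢0 (k !) 4 {{ℕ._!≢0 k}}

Integral : ℕ → ℚ → Set
Integral p a = Coprime (↧ₙ a) p

-- a ≡ b [mod p ↑ m ] is congruence modulo p ^ m; it is only defined for
-- p-integral a and b, so their integrality is part of the relation.
infix 4 _≡_[mod_↑_]

record _≡_[mod_↑_] (a b : ℚ) (p m : ℕ) : Set where
  field
    integralˡ : Integral p a
    integralʳ : Integral p b
    quotient  : ∃ λ c → Integral p c × a - b ≡ fromℤ (+ (p ℕ.^ m)) * c

i^n≢0 : ∀ i n → .{{_ : ℤ.NonZero i}} → ℤ.NonZero (i ℤ.^ n)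
i^n≢0 i zero            = _
i^n≢0 i (suc n) {{i≢0}} = ℤ.i*j≢0 i (i ℤ.^ n) {{i≢0}} {{i^n≢0 i n {{i≢0}}}}

infixl 7 _÷[_↑_]

_÷[_↑_] : ℚ → (i : ℤ) → .{{_ : ℤ.NonZero i}} → ℕ → ℚ
a ÷[ i ↑ n ] = _÷_ a (fromℤ (i ℤ.^ n)) {{i^n≢0 i n}}

{-# OPTIONS --safe #-}
-- Write p = 2N + 1 and work with integers modulo p⁴, where every i prime to p has
-- an inverse.  A WZ pair (S, G), with S 0 n n the n-th summand, telescopes the sum
-- to S N 0 N + ∑_{k<N} G k (N - k) N.  Put X(s) = ∏_{i=1}^N (1 + s p/(2i)).  Then
-- S N 0 N = 3p κ X(1) X(-3), while G k (N - k) N = p² κ X(-1)² τ k, where 16^N κ =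
-- (-1)^N and τ k involves only X(1) and the numbers 1/(2j+1), j ≤ k.  As ∑ 1/i²
-- vanishes modulo p, X(s) is modulo p³ the exponential exp(s x) with x = p/2 ∑ 1/i.
-- Computing (2N)! in two ways gives 4^N X(-1) = X(-2), so 2^{p-1} = exp(-x) modulo
-- p³, and both sides of the congruence become polynomials in x.
module Submission where

open import Data.Nat.Base as ℕ using (ℕ; zero; suc; _<_; _≤_; _∸_; _!; z≤n; s≤s)
import Data.Nat.Divisibility as ℕ
open import Data.Nat.Primality using (Prime; euclidsLemma; prime⇒irreducible; prime⇒nonTrivial; prime⇒nonZero)
import Data.Nat.Properties as ℕ
open import Data.Product.Base using (∃; _,_; proj₁; proj₂)
open import Data.Sum.Base using (_⊎_; inj₁; inj₂; [_,_]′)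
open import Function.Base using (_∘_)
open import Relation.Binary.PropositionalEquality
  using (_≡_; refl; sym; trans; cong; cong₂; subst; module ≡-Reasoning)
open import Relation.Nullary.Negation using (¬_; contradiction)

-- The arguments of `X` in the two closed forms have the same sum: 1 + (-3) and (-1) + (-1). Modulo
-- p³ both products are therefore exp(-2x), which is 16^N, and κ turns it into the sign (-1)^N. What
-- remains is p (-1)^N (3 + p ∑ τ k), so the whole correction to the constant 3 sits in ∑ τ k. The
-- precision drops with each explicit factor p: the first makes p³ enough for `X`, the second makes
-- p² enough for ∑ τ k, and inside that sum the coefficient of p matters only modulo p. The powers
-- of p come from the double factorials. Along n = N they run past p but stop short of 3p, so p can
-- be split off as an integer factor before any inverse is taken; every other factor is p or 3p plus
-- or minus a small even number, up to a single 2p + 1 and its analogues in τ. The sign on the right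
-- is a Legendre symbol decided by a search for a square root of -1. Matching it with (-1)^N goes
-- through the theorems of Fermat and Wilson.

module Congruences where

  open import Algebra.Structures using (IsCommutativeMonoid)
  open import Data.Integer.Base as ℤ using (ℤ; +_; -_; 0ℤ; 1ℤ; -1ℤ; _+_; _*_; _-_; _^_)
  open import Data.Integer.Divisibility.Signed using (_∣_; divides)
  import Data.Integer.Properties as ℤ
  open import Data.Integer.Tactic.RingSolver using (solve-∀)
  open import Level using (0ℓ)
  open import Relation.Binary.Bundles using (Setoid)
  import Relation.Binary.Reasoning.Setoid as SetoidReasoning

  -- Congruences with explicit quotients

  infix 4 _≅_⟨mod_⟩

  -- The equation is solved for `a`, so that matching on `refl` eliminates `a` and leaves a
  -- polynomial identity in the other variables.
  record _≅_⟨mod_⟩ (a b q : ℤ) : Set where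
    constructor modulo
    field
      multiple : ℤ
      equation : a ≡ b + multiple * q

  private variable
    a b c d a₁ b₁ a₂ b₂ a₃ b₃ q r : ℤ

  difference⇒≅ : ∀ m → a + - b ≡ m * q → a ≅ b ⟨mod q ⟩
  difference⇒≅ {a} {b} {q} m eq = modulo m (trans (split a b) (cong (λ x → b + x) eq))
    where
    split : ∀ a b → a ≡ b + (a + - b)
    split = solve-∀

  ≅⇒∣ : a ≅ b ⟨mod q ⟩ → q ∣ a - b
  ≅⇒∣ {a} {b} {q} (modulo m eq) = divides m (trans (cong (_- b) eq) (cancel b m q))
    where
    cancel : ∀ b m q → b + m * q + - b ≡ m * q
    cancel = solve-∀

  ∣⇒≅ : q ∣ a - b → a ≅ b ⟨mod q ⟩
  ∣⇒≅ (divides m eq) = difference⇒≅ m eq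

  -- A certificate of ideal membership: the cofactor is supplied by hand and the ring solver checks
  -- the identity. Most facts about inverses below are proved in this way, with relations such as
  -- `u * v ≅ 1ℤ` as generators.
  combination₁ : ∀ m → a + - b ≡ m * (a₁ + - b₁) →
    a₁ ≅ b₁ ⟨mod q ⟩ → a ≅ b ⟨mod q ⟩
  combination₁ {b₁ = b₁} {q} m eq (modulo n refl) =
    difference⇒≅ (m * n) (trans eq (collect b₁ n m q))
    where
    collect : ∀ b₁ n m q → m * (b₁ + n * q + - b₁) ≡ m * n * q
    collect = solve-∀

  combination₂ : ∀ m₁ m₂ → a + - b ≡ m₁ * (a₁ + - b₁) + m₂ * (a₂ + - b₂) →
    a₁ ≅ b₁ ⟨mod q ⟩ → a₂ ≅ b₂ ⟨mod q ⟩ → a ≅ b ⟨mod q ⟩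
  combination₂ {b₁ = b₁} {b₂ = b₂} {q} m₁ m₂ eq (modulo n₁ refl) (modulo n₂ refl) =
    difference⇒≅ (m₁ * n₁ + m₂ * n₂) (trans eq (collect b₁ b₂ n₁ n₂ m₁ m₂ q))
    where
    collect : ∀ b₁ b₂ n₁ n₂ m₁ m₂ q →
      m₁ * (b₁ + n₁ * q + - b₁) + m₂ * (b₂ + n₂ * q + - b₂) ≡ (m₁ * n₁ + m₂ * n₂) * q
    collect = solve-∀

  combination₃ : ∀ m₁ m₂ m₃ →
    a + - b ≡ m₁ * (a₁ + - b₁) + m₂ * (a₂ + - b₂) + m₃ * (a₃ + - b₃) →
    a₁ ≅ b₁ ⟨mod q ⟩ → a₂ ≅ b₂ ⟨mod q ⟩ → a₃ ≅ b₃ ⟨mod q ⟩ → a ≅ b ⟨mod q ⟩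
  combination₃ {b₁ = b₁} {b₂ = b₂} {b₃ = b₃} {q} m₁ m₂ m₃ eq
    (modulo n₁ refl) (modulo n₂ refl) (modulo n₃ refl) =
    difference⇒≅ (m₁ * n₁ + m₂ * n₂ + m₃ * n₃)
      (trans eq (collect b₁ b₂ b₃ n₁ n₂ n₃ m₁ m₂ m₃ q))
    where
    collect : ∀ b₁ b₂ b₃ n₁ n₂ n₃ m₁ m₂ m₃ q →
      m₁ * (b₁ + n₁ * q + - b₁) + m₂ * (b₂ + n₂ * q + - b₂) + m₃ * (b₃ + n₃ * q + - b₃)
        ≡ (m₁ * n₁ + m₂ * n₂ + m₃ * n₃) * q
    collect = solve-∀

  ≡⇒≅ : a ≡ b → a ≅ b ⟨mod q ⟩
  ≡⇒≅ {a} refl = modulo 0ℤ (sym (ℤ.+-identityʳ a))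

  ≅-refl : a ≅ a ⟨mod q ⟩
  ≅-refl = ≡⇒≅ refl

  ≅-sym : a ≅ b ⟨mod q ⟩ → b ≅ a ⟨mod q ⟩
  ≅-sym {a} {b} = combination₁ -1ℤ (flip a b)
    where
    flip : ∀ a b → b + - a ≡ -1ℤ * (a + - b)
    flip = solve-∀

  ≅-trans : a ≅ b ⟨mod q ⟩ → b ≅ c ⟨mod q ⟩ → a ≅ c ⟨mod q ⟩
  ≅-trans {a} {b} {q} {c} = combination₂ 1ℤ 1ℤ (telescope a b c)
    where
    telescope : ∀ a b c → a + - c ≡ 1ℤ * (a + - b) + 1ℤ * (b + - c)
    telescope = solve-∀

  +-cong-≅ : a ≅ b ⟨mod q ⟩ → c ≅ d ⟨mod q ⟩ → a + c ≅ b + d ⟨mod q ⟩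
  +-cong-≅ {a} {b} {q} {c} {d} = combination₂ 1ℤ 1ℤ (identity a b c d)
    where
    identity : ∀ a b c d → a + c + - (b + d) ≡ 1ℤ * (a + - b) + 1ℤ * (c + - d)
    identity = solve-∀

  *-cong-≅ : a ≅ b ⟨mod q ⟩ → c ≅ d ⟨mod q ⟩ → a * c ≅ b * d ⟨mod q ⟩
  *-cong-≅ {a} {b} {q} {c} {d} = combination₂ c b (identity a b c d)
    where
    identity : ∀ a b c d → a * c + - (b * d) ≡ c * (a + - b) + b * (c + - d)
    identity = solve-∀

  *-congˡ-≅ : ∀ c → a ≅ b ⟨mod q ⟩ → c * a ≅ c * b ⟨mod q ⟩
  *-congˡ-≅ c = *-cong-≅ (≅-refl {c})

  ^-cong-≅ : ∀ n → a ≅ b ⟨mod q ⟩ → a ^ n ≅ b ^ n ⟨mod q ⟩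
  ^-cong-≅ zero    a≅b = ≅-refl
  ^-cong-≅ (suc n) a≅b = *-cong-≅ a≅b (^-cong-≅ n a≅b)

  scale-≅ : ∀ r → a ≅ b ⟨mod q ⟩ → r * a ≅ r * b ⟨mod r * q ⟩
  scale-≅ {a} {b} {q} r (modulo m eq) = modulo m (trans (cong (r *_) eq) (distribute r b m q))
    where
    distribute : ∀ r b m q → r * (b + m * q) ≡ r * b + m * (r * q)
    distribute = solve-∀

  weaken-≅ : ∀ r → a ≅ b ⟨mod r * q ⟩ → a ≅ b ⟨mod q ⟩
  weaken-≅ {b = b} {q} r (modulo m eq) =
    modulo (m * r) (trans eq (cong (λ x → b + x) (sym (ℤ.*-assoc m r q))))

  cancel-≅ : ∀ {u v} → u * v ≅ 1ℤ ⟨mod q ⟩ → u * a ≅ u * b ⟨mod q ⟩ → a ≅ b ⟨mod q ⟩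
  cancel-≅ {q} {a} {b} {u} {v} = combination₂ (b + - a) v (identity a b u v)
    where
    identity : ∀ a b u v → a + - b ≡ (b + - a) * (u * v + - 1ℤ) + v * (u * a + - (u * b))
    identity = solve-∀

  modularSetoid : ℤ → Setoid 0ℓ 0ℓ
  modularSetoid q = record
    { Carrier       = ℤ
    ; _≈_           = _≅_⟨mod q ⟩
    ; isEquivalence = record { refl = ≅-refl ; sym = ≅-sym ; trans = ≅-trans }
    }

  module ≅-Reasoning (q : ℤ) = SetoidReasoning (modularSetoid q)

  module _ (q : ℤ) where

    +-isCommutativeMonoid-≅ : IsCommutativeMonoid _≅_⟨mod q ⟩ _+_ 0ℤ
    +-isCommutativeMonoid-≅ = record
      { isMonoid = record
        { isSemigroup = record
          { isMagma = record
            { isEquivalence = Setoid.isEquivalence (modularSetoid q)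
            ; ∙-cong        = +-cong-≅
            }
          ; assoc = λ a b c → ≡⇒≅ (ℤ.+-assoc a b c)
          }
        ; identity = (λ a → ≡⇒≅ (ℤ.+-identityˡ a)) , (λ a → ≡⇒≅ (ℤ.+-identityʳ a))
        }
      ; comm = λ a b → ≡⇒≅ (ℤ.+-comm a b)
      }

    *-isCommutativeMonoid-≅ : IsCommutativeMonoid _≅_⟨mod q ⟩ _*_ 1ℤ
    *-isCommutativeMonoid-≅ = record
      { isMonoid = record
        { isSemigroup = record
          { isMagma = record
            { isEquivalence = Setoid.isEquivalence (modularSetoid q)
            ; ∙-cong        = *-cong-≅
            }
          ; assoc = λ a b c → ≡⇒≅ (ℤ.*-assoc a b c)
          }
        ; identity = (λ a → ≡⇒≅ (ℤ.*-identityˡ a)) , (λ a → ≡⇒≅ (ℤ.*-identityʳ a))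
        }
      ; comm = λ a b → ≡⇒≅ (ℤ.*-comm a b)
      }

  -- Sums and products over the range 0 ≤ i < n

  fold : {A : Set} → (A → A → A) → A → ℕ → (ℕ → A) → A
  fold _∙_ ε zero    f = ε
  fold _∙_ ε (suc n) f = fold _∙_ ε n f ∙ f n

  ∑ ∏ : ℕ → (ℕ → ℤ) → ℤ
  ∑ = fold _+_ 0ℤ
  ∏ = fold _*_ 1ℤ

  module FoldProperties {A : Set} {_≈_ : A → A → Set} {_∙_ : A → A → A} {ε : A}
    (isCommutativeMonoid : IsCommutativeMonoid _≈_ _∙_ ε) where

    open IsCommutativeMonoid isCommutativeMonoid
      using (∙-cong; ∙-congˡ; ∙-congʳ; assoc; comm; identityˡ; identityʳ; setoid)
      renaming (refl to ≈-refl; sym to ≈-sym; trans to ≈-trans; reflexive to ≈-reflexive)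
    open SetoidReasoning setoid

    private
      ⨀ : ℕ → (ℕ → A) → A
      ⨀ = fold _∙_ ε

    fold-cong : ∀ n {f g} → (∀ i → i < n → f i ≈ g i) → ⨀ n f ≈ ⨀ n g
    fold-cong zero    f≈g = ≈-refl
    fold-cong (suc n) f≈g =
      ∙-cong (fold-cong n λ i i<n → f≈g i (ℕ.m<n⇒m<1+n i<n)) (f≈g n ℕ.≤-refl)

    fold-head : ∀ n f → ⨀ (suc n) f ≈ (f 0 ∙ ⨀ n (f ∘ suc))
    fold-head zero    f = comm ε (f 0)
    fold-head (suc n) f = ≈-trans (∙-congʳ (fold-head n f)) (assoc _ _ _)

    fold-++ : ∀ m n f → ⨀ (m ℕ.+ n) f ≈ (⨀ m f ∙ ⨀ n (λ i → f (m ℕ.+ i)))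
    fold-++ m zero    f = ≈-trans (≈-reflexive (cong (λ k → ⨀ k f) (ℕ.+-identityʳ m))) (≈-sym (identityʳ _))
    fold-++ m (suc n) f = begin
      ⨀ (m ℕ.+ suc n) f                                      ≡⟨ cong (λ k → ⨀ k f) (ℕ.+-suc m n) ⟩
      ⨀ (m ℕ.+ n) f ∙ f (m ℕ.+ n)                            ≈⟨ ∙-congʳ (fold-++ m n f) ⟩
      (⨀ m f ∙ ⨀ n (λ i → f (m ℕ.+ i))) ∙ f (m ℕ.+ n)        ≈⟨ assoc _ _ _ ⟩
      ⨀ m f ∙ ⨀ (suc n) (λ i → f (m ℕ.+ i))                  ∎

    -- Pairing indices by `suc (i ℕ.+ j) ≡ n` avoids truncated subtraction: the recursion takes f
    -- from the front and g from the back.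
    fold-reverse : ∀ n {f g} → (∀ i j → suc (i ℕ.+ j) ≡ n → f i ≈ g j) → ⨀ n f ≈ ⨀ n g
    fold-reverse zero            f≈g = ≈-refl
    fold-reverse (suc n) {f} {g} f≈g = begin
      ⨀ (suc n) f           ≈⟨ fold-head n f ⟩
      f 0 ∙ ⨀ n (f ∘ suc)   ≈⟨ ∙-cong (f≈g 0 n refl) (fold-reverse n λ i j eq → f≈g (suc i) j (cong suc eq)) ⟩
      g n ∙ ⨀ n g           ≈⟨ comm _ _ ⟩
      ⨀ n g ∙ g n           ∎

    fold-∙ : ∀ n f g → ⨀ n (λ i → f i ∙ g i) ≈ (⨀ n f ∙ ⨀ n g)
    fold-∙ zero    f g = ≈-sym (identityˡ ε)
    fold-∙ (suc n) f g = begin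
      ⨀ n (λ i → f i ∙ g i) ∙ (f n ∙ g n)  ≈⟨ ∙-congʳ (fold-∙ n f g) ⟩
      (⨀ n f ∙ ⨀ n g) ∙ (f n ∙ g n)        ≈⟨ assoc _ _ _ ⟩
      ⨀ n f ∙ (⨀ n g ∙ (f n ∙ g n))        ≈⟨ ∙-congˡ (assoc _ _ _) ⟨
      ⨀ n f ∙ ((⨀ n g ∙ f n) ∙ g n)        ≈⟨ ∙-congˡ (∙-congʳ (comm _ _)) ⟩
      ⨀ n f ∙ ((f n ∙ ⨀ n g) ∙ g n)        ≈⟨ ∙-congˡ (assoc _ _ _) ⟩
      ⨀ n f ∙ (f n ∙ (⨀ n g ∙ g n))        ≈⟨ assoc _ _ _ ⟨
      (⨀ n f ∙ f n) ∙ (⨀ n g ∙ g n)        ∎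

    fold-pairs : ∀ n f → ⨀ (n ℕ.+ n) f ≈ ⨀ n (λ i → f (i ℕ.+ i) ∙ f (suc (i ℕ.+ i)))
    fold-pairs zero    f = ≈-refl
    fold-pairs (suc n) f = begin
      ⨀ (n ℕ.+ suc n) f ∙ f (n ℕ.+ suc n)                ≡⟨ cong (λ k → ⨀ k f ∙ f k) (ℕ.+-suc n n) ⟩
      (⨀ (n ℕ.+ n) f ∙ f (n ℕ.+ n)) ∙ f (suc (n ℕ.+ n))  ≈⟨ assoc _ _ _ ⟩
      ⨀ (n ℕ.+ n) f ∙ (f (n ℕ.+ n) ∙ f (suc (n ℕ.+ n)))  ≈⟨ ∙-congʳ (fold-pairs n f) ⟩
      ⨀ (suc n) (λ i → f (i ℕ.+ i) ∙ f (suc (i ℕ.+ i)))  ∎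

  module ∑≅ (q : ℤ) = FoldProperties (+-isCommutativeMonoid-≅ q)
  module ∏≅ (q : ℤ) = FoldProperties (*-isCommutativeMonoid-≅ q)
  module ∑≡ = FoldProperties ℤ.+-0-isCommutativeMonoid
  module ∏≡ = FoldProperties ℤ.*-1-isCommutativeMonoid

  ∑-distribˡ : ∀ n c f → ∑ n (λ i → c * f i) ≡ c * ∑ n f
  ∑-distribˡ zero    c f = sym (ℤ.*-zeroʳ c)
  ∑-distribˡ (suc n) c f = trans (cong (_+ c * f n) (∑-distribˡ n c f)) (sym (ℤ.*-distribˡ-+ c _ _))

  ∏-const : ∀ n c → ∏ n (λ _ → c) ≡ c ^ n
  ∏-const zero    c = refl
  ∏-const (suc n) c = trans (ℤ.*-comm _ c) (cong (c *_) (∏-const n c))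

  ^-*-swap : ∀ a b n → (a * b) ^ n ≡ a ^ n * b ^ n
  ^-*-swap a b zero    = refl
  ^-*-swap a b (suc n) = trans (cong (a * b *_) (^-*-swap a b n)) (interchange a b (a ^ n) (b ^ n))
    where
    interchange : ∀ a b x y → a * b * (x * y) ≡ a * x * (b * y)
    interchange = solve-∀

open Congruences

module Integers where

  open import Defs using (legendre)
  open import Data.Bool.Base using (if_then_else_)
  open import Data.Fin.Base as Fin using (Fin; toℕ; fromℕ<; inject₁; fromℕ)
  import Data.Fin.Properties as Fin
  open import Data.Integer.Base as ℤ using (ℤ; +_; -_; 0ℤ; 1ℤ; -1ℤ; _+_; _*_; _-_; _^_)
  open import Data.Integer.Divisibility.Signed using (_∣_; _∣?_; ∣⇒∣ᵤ)
  import Data.Integer.Properties as ℤ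
  open import Data.Integer.Tactic.RingSolver using (solve-∀)
  open import Data.Nat.Combinatorics using (_C_; nCn≡1; nCk≡nC[n∸k]; nCk≡n!/k![n-k]!; k![n∸k]!∣n!)
  open import Data.Nat.Coprimality using (Coprime; coprime-Bézout)
  open import Data.Nat.DivMod using (_%_; m%n<n; m≡m%n+[m/n]*n; m/n*n≡m)
  open import Data.Nat.GCD using (module Bézout)
  open import Data.Vec.Functional using (tail; init; last)
  open import Relation.Nullary.Decidable using (does; yes; no; dec-true; dec-false)
  import Algebra.Properties.CommutativeSemiring.Binomial ℤ.+-*-commutativeSemiring as Binomial
  open import Algebra.Properties.Monoid.Sum ℤ.+-0-monoid using (sum; sum-init-last)
  open import Algebra.Properties.Semiring.Exp ℤ.+-*-semiring using () renaming (_^_ to _^ˢ_)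
  open import Algebra.Properties.Semiring.Mult ℤ.+-*-semiring using () renaming (_×_ to _×ˢ_)

  -- Units modulo powers of a prime

  module _ {p : ℕ} (p-prime : Prime p) where

    ∤-coprime : ∀ {i} → ¬ p ℕ.∣ i → Coprime p i
    ∤-coprime p∤i (d∣p , d∣i) with prime⇒irreducible p-prime d∣p
    ... | inj₁ d≡1  = d≡1
    ... | inj₂ refl = contradiction d∣i p∤i

    ∤-* : ∀ m n → ¬ p ℕ.∣ m → ¬ p ℕ.∣ n → ¬ p ℕ.∣ m ℕ.* n
    ∤-* m n p∤m p∤n = [ p∤m , p∤n ]′ ∘ euclidsLemma m n p-prime

    p∤1 : ¬ p ℕ.∣ 1
    p∤1 p∣1 with refl ← ℕ.∣1⇒≡1 p∣1 = ℕ.<-irrefl refl (ℕ.nonTrivial⇒n>1 1 {{prime⇒nonTrivial p-prime}})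

    ∤-^ : ∀ m n → ¬ p ℕ.∣ m → ¬ p ℕ.∣ m ℕ.^ n
    ∤-^ m zero    p∤m = p∤1
    ∤-^ m (suc n) p∤m = ∤-* m (m ℕ.^ n) p∤m (∤-^ m n p∤m)

    <⇒∤ : ∀ {i} → suc i < p → ¬ p ℕ.∣ suc i
    <⇒∤ i<p p∣i = ℕ.<⇒≱ i<p (ℕ.∣⇒≤ p∣i)

    ∤-! : ∀ n → n < p → ¬ p ℕ.∣ n !
    ∤-! zero    n<p = p∤1
    ∤-! (suc n) n<p = ∤-* (suc n) (n !) (<⇒∤ n<p) (∤-! n (ℕ.<-trans (ℕ.n<1+n n) n<p))

    inverse-mod-p : ∀ i → ¬ p ℕ.∣ i → ∃ λ u → + i * u ≅ 1ℤ ⟨mod + p ⟩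
    inverse-mod-p i p∤i with coprime-Bézout (∤-coprime p∤i)
    ... | Bézout.+- x y eq = - + y , modulo (- + x) (begin
      + i * - + y             ≡⟨ identity (+ i) (+ y) ⟩
      1ℤ + - (1ℤ + + y * + i) ≡⟨ cong (λ z → 1ℤ + - (1ℤ + z)) (ℤ.pos-* y i) ⟨
      1ℤ + - + (1 ℕ.+ y ℕ.* i) ≡⟨ cong (λ z → 1ℤ + - + z) eq ⟩
      1ℤ + - + (x ℕ.* p)      ≡⟨ cong (λ z → 1ℤ + - z) (ℤ.pos-* x p) ⟩
      1ℤ + - (+ x * + p)      ≡⟨ cong (λ z → 1ℤ + z) (ℤ.neg-distribˡ-* (+ x) (+ p)) ⟩
      1ℤ + - + x * + p        ∎)
      where
      open ≡-Reasoning
      identity : ∀ i y → i * - y ≡ 1ℤ + - (1ℤ + y * i)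
      identity = solve-∀
    ... | Bézout.-+ x y eq = + y , modulo (+ x) (begin
      + i * + y             ≡⟨ ℤ.pos-* i y ⟨
      + (i ℕ.* y)           ≡⟨ cong +_ (ℕ.*-comm i y) ⟩
      + (y ℕ.* i)           ≡⟨ cong +_ eq ⟨
      1ℤ + + (x ℕ.* p)      ≡⟨ cong (λ z → 1ℤ + z) (ℤ.pos-* x p) ⟩
      1ℤ + + x * + p        ∎)
      where open ≡-Reasoning

    -- If i u = 1 - s with p ∣ s, then i u (1 + s) (1 + s²) = 1 - s⁴.
    inverse-mod-p⁴ : ∀ i → ¬ p ℕ.∣ i → ∃ λ u → + i * u ≅ 1ℤ ⟨mod (+ p) ^ 4 ⟩
    inverse-mod-p⁴ i p∤i with inverse-mod-p i p∤i
    ... | u , modulo m eq = u * ((1ℤ + s) * (1ℤ + s * s)) , modulo (- (m ^ 4))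
      (trans (sym (ℤ.*-assoc (+ i) u _))
        (trans (cong (_* ((1ℤ + s) * (1ℤ + s * s))) eq) (telescope m (+ p))))
      where
      s = - (m * + p)
      telescope : ∀ m p → (1ℤ + m * p) * ((1ℤ + - (m * p)) * (1ℤ + - (m * p) * - (m * p)))
        ≡ 1ℤ + - (m * (m * (m * (m * 1ℤ)))) * (p * (p * (p * (p * 1ℤ))))
      telescope = solve-∀

    abstract

      -- The value 0 at multiples of p is a filler that makes `recip` total. The definition is
      -- abstract so that Bézout coefficients are never unfolded.
      recip : ℕ → ℤ
      recip i with p ℕ.∣? i
      ... | yes _  = 0ℤ
      ... | no p∤i = proj₁ (inverse-mod-p⁴ i p∤i)

      recip-inverse : ∀ i → ¬ p ℕ.∣ i → + i * recip i ≅ 1ℤ ⟨mod (+ p) ^ 4 ⟩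
      recip-inverse i p∤i with p ℕ.∣? i
      ... | yes p∣i = contradiction p∣i p∤i
      ... | no  _   = proj₂ (inverse-mod-p⁴ i _)

  -- Second elementary symmetric sums and products of odd numbers

  ∑-of-products : (ℕ → ℤ) → ℕ → ℤ
  ∑-of-products f n = ∑ n λ i → f i * ∑ i f

  -- Newton's identity e₁² = 2 e₂ + p₂, where `∑-of-products` is e₂ grouped by the larger index.
  -- Once the sum of squares vanishes, e₂ is determined by the sum alone.
  square-of-∑ : ∀ f n → ∑ n f * ∑ n f ≡
    ∑-of-products f n + ∑-of-products f n + ∑ n (λ i → f i * f i)
  square-of-∑ f zero    = refl
  square-of-∑ f (suc n) = begin
    (s + t) * (s + t)               ≡⟨ expand s t ⟩
    s * s + + 2 * (t * s) + t * t   ≡⟨ cong (λ z → z + + 2 * (t * s) + t * t) (square-of-∑ f n) ⟩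
    e + e + r + + 2 * (t * s) + t * t ≡⟨ collect e r (t * s) (t * t) ⟩
    e + t * s + (e + t * s) + (r + t * t) ∎
    where
    open ≡-Reasoning
    s = ∑ n f
    t = f n
    e = ∑-of-products f n
    r = ∑ n λ i → f i * f i
    expand : ∀ s t → (s + t) * (s + t) ≡ s * s + + 2 * (t * s) + t * t
    expand = solve-∀
    collect : ∀ e r u w → e + e + r + + 2 * u + w ≡ e + u + (e + u) + (r + w)
    collect = solve-∀

  -1^n*-1^n≡1 : ∀ n → -1ℤ ^ n * -1ℤ ^ n ≡ 1ℤ
  -1^n*-1^n≡1 n = trans (sym (^-*-swap -1ℤ -1ℤ n)) (ℤ.^-zeroˡ n)

  -- The double factorial (2n - 1)!!.
  odd : ℕ → ℤ
  odd n = ∏ n λ i → + suc (i ℕ.+ i)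

  ∏-suc-double : ∀ n → ∏ (n ℕ.+ n) (λ i → + suc i) ≡ odd n * ((+ 2) ^ n * ∏ n (λ i → + suc i))
  ∏-suc-double n = begin
    ∏ (n ℕ.+ n) (λ i → + suc i)        ≡⟨ ∏≡.fold-pairs n (λ i → + suc i) ⟩
    ∏ n (λ i → + suc (i ℕ.+ i) * + suc (suc (i ℕ.+ i))) ≡⟨ ∏≡.fold-∙ n (λ i → + suc (i ℕ.+ i)) (λ i → + suc (suc (i ℕ.+ i))) ⟩
    odd n * ∏ n (λ i → + suc (suc (i ℕ.+ i))) ≡⟨ cong (odd n *_) (∏≡.fold-cong n (λ i _ → double (+ i))) ⟨
    odd n * ∏ n (λ i → + 2 * + suc i)  ≡⟨ cong (odd n *_) (∏≡.fold-∙ n (λ _ → + 2) (λ i → + suc i)) ⟩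
    odd n * (∏ n (λ _ → + 2) * ∏ n (λ i → + suc i)) ≡⟨ cong (λ z → odd n * (z * ∏ n (λ i → + suc i))) (∏-const n (+ 2)) ⟩
    odd n * ((+ 2) ^ n * ∏ n (λ i → + suc i)) ∎
    where
    open ≡-Reasoning
    double : ∀ i → + 2 * (1ℤ + i) ≡ + 2 + (i + i)
    double = solve-∀

  -- Fermat's little theorem

  ^ˢ≡^ : ∀ i n → i ^ˢ n ≡ i ^ n
  ^ˢ≡^ i zero    = refl
  ^ˢ≡^ i (suc n) = cong (i *_) (^ˢ≡^ i n)

  ×ˢ≡* : ∀ n i → n ×ˢ i ≡ + n * i
  ×ˢ≡* zero    i = refl
  ×ˢ≡* (suc n) i = trans (cong (λ z → i + z) (×ˢ≡* n i)) (sym (ℤ.suc-* (+ n) i))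

  sum-≅0 : ∀ {n q} (f : Fin n → ℤ) → (∀ i → f i ≅ 0ℤ ⟨mod q ⟩) → sum f ≅ 0ℤ ⟨mod q ⟩
  sum-≅0 {zero}  f f≅0 = ≅-refl
  sum-≅0 {suc n} f f≅0 = +-cong-≅ (f≅0 Fin.zero) (sum-≅0 (λ i → f (Fin.suc i)) (λ i → f≅0 (Fin.suc i)))

  n∣n! : ∀ n .{{_ : ℕ.NonZero n}} → n ℕ.∣ n !
  n∣n! (suc n) = ℕ.m∣m*n (n !)

  ∣⇒≅0 : ∀ {m n} → m ℕ.∣ n → + n ≅ 0ℤ ⟨mod + m ⟩
  ∣⇒≅0 {m} (ℕ.divides q refl) = modulo (+ q) (trans (ℤ.pos-* q m) (sym (ℤ.+-identityˡ _)))

  module _ {p : ℕ} (p-prime : Prime p) where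

    -- In p! = C(p, k+1) (k+1)! (p-k-1)! the prime p divides the left side but neither factorial on
    -- the right.
    p∣pCk : ∀ {k} → suc k < p → p ℕ.∣ p C suc k
    p∣pCk {k} k<p = [ (λ p∣ → p∣) , (λ p∣ → contradiction p∣ p∤) ]′
      (euclidsLemma (p C suc k) (suc k ! ℕ.* (p ∸ suc k) !) p-prime (subst (p ℕ.∣_) (sym factorization) p∣p!))
      where
      instance
        _ = ℕ._!*_!≢0 (suc k) (p ∸ suc k)
      factorization : (p C suc k) ℕ.* (suc k ! ℕ.* (p ∸ suc k) !) ≡ p !
      factorization = trans (cong (ℕ._* (suc k ! ℕ.* (p ∸ suc k) !)) (nCk≡n!/k![n-k]! (ℕ.<⇒≤ k<p)))
        (m/n*n≡m (k![n∸k]!∣n! (ℕ.<⇒≤ k<p)))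
      p∣p! : p ℕ.∣ p !
      p∣p! = n∣n! p {{prime⇒nonZero p-prime}}
      p∤ : ¬ p ℕ.∣ suc k ! ℕ.* (p ∸ suc k) !
      p∤ = ∤-* p-prime (suc k !) ((p ∸ suc k) !) (∤-! p-prime (suc k) k<p) (∤-! p-prime (p ∸ suc k) (ℕ.∸-monoʳ-< (s≤s z≤n) (ℕ.<⇒≤ k<p)))

  module _ {q : ℕ} (p-prime : Prime (suc q)) where

    private
      p = suc q

    freshmans-dream : ∀ x → (x + 1ℤ) ^ p ≅ x ^ p + 1ℤ ⟨mod + p ⟩
    freshmans-dream x = begin
      (x + 1ℤ) ^ p                                   ≡⟨ ^ˢ≡^ (x + 1ℤ) p ⟨
      (x + 1ℤ) ^ˢ p                                  ≡⟨ Binomial.theorem p x 1ℤ ⟩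
      term Fin.zero + sum (tail term)                ≡⟨ cong (λ z → term Fin.zero + z) (sum-init-last (tail term)) ⟩
      term Fin.zero + (sum (init (tail term)) + last (tail term))
        ≈⟨ +-cong-≅ (≡⇒≅ first) (+-cong-≅ (sum-≅0 (init (tail term)) middle) (≡⇒≅ final)) ⟩
      1ℤ + (0ℤ + x ^ p)                              ≡⟨ swap (x ^ p) ⟩
      x ^ p + 1ℤ                                     ∎
      where
      open ≅-Reasoning (+ p)
      term : Fin (suc p) → ℤ
      term = Binomial.binomialTerm x 1ℤ p
      swap : ∀ y → 1ℤ + (0ℤ + y) ≡ y + 1ℤ
      swap = solve-∀
      term≡ : ∀ k → term k ≡ + (p C toℕ k) * x ^ toℕ k
      term≡ k = trans (×ˢ≡* (p C toℕ k) _) (cong (+ (p C toℕ k) *_)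
        (trans (cong₂ _*_ (^ˢ≡^ x (toℕ k)) (trans (^ˢ≡^ 1ℤ (p ∸ toℕ k)) (ℤ.^-zeroˡ (p ∸ toℕ k)))) (ℤ.*-identityʳ _)))
      first : term Fin.zero ≡ 1ℤ
      first = trans (term≡ Fin.zero) (cong (λ n → + n * 1ℤ) (trans (nCk≡nC[n∸k] {0} {p} z≤n) (nCn≡1 p)))
      final : last (tail term) ≡ x ^ p
      final = trans (term≡ (Fin.suc (fromℕ q))) (trans (cong (λ k → + (p C suc k) * x ^ suc k) (Fin.toℕ-fromℕ q))
        (trans (cong (λ n → + n * x ^ p) (nCn≡1 p)) (ℤ.*-identityˡ (x ^ p))))
      middle : ∀ i → init (tail term) i ≅ 0ℤ ⟨mod + p ⟩
      middle i = ≅-trans (≡⇒≅ (trans (term≡ (Fin.suc (inject₁ i))) (cong (λ k → + (p C suc k) * x ^ suc k) (Fin.toℕ-inject₁ i))))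
        (*-cong-≅ (∣⇒≅0 (p∣pCk p-prime (s≤s (Fin.toℕ<n i)))) (≅-refl {x ^ suc (toℕ i)}))

    fermat : ∀ n → (+ n) ^ p ≅ + n ⟨mod + p ⟩
    fermat zero    = ≅-refl
    fermat (suc n) = begin
      (+ suc n) ^ p     ≡⟨ cong (_^ p) (ℤ.+-comm 1ℤ (+ n)) ⟩
      (+ n + 1ℤ) ^ p    ≈⟨ freshmans-dream (+ n) ⟩
      (+ n) ^ p + 1ℤ    ≈⟨ +-cong-≅ (fermat n) ≅-refl ⟩
      + n + 1ℤ          ≡⟨ ℤ.+-comm (+ n) 1ℤ ⟩
      + suc n           ∎
      where open ≅-Reasoning (+ p)

  -- Finite differences and Wilson's theorem

  Δ : ℕ → (ℕ → ℤ) → ℕ → ℤ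
  Δ zero    f x = f x
  Δ (suc m) f x = Δ m f (suc x) + - Δ m f x

  Δ-cong : ∀ m {f g q} x → (∀ i → i ≤ m ℕ.+ x → f i ≅ g i ⟨mod q ⟩) → Δ m f x ≅ Δ m g x ⟨mod q ⟩
  Δ-cong zero    x f≅g = f≅g x ℕ.≤-refl
  Δ-cong (suc m) {f} {g} x f≅g = combination₂ 1ℤ -1ℤ (identity (Δ m f (suc x)) (Δ m f x) (Δ m g (suc x)) (Δ m g x))
    (Δ-cong m (suc x) λ i i≤ → f≅g i (subst (i ≤_) (ℕ.+-suc m x) i≤))
    (Δ-cong m x λ i i≤ → f≅g i (ℕ.m≤n⇒m≤1+n i≤))
    where
    identity : ∀ a b c d → a + - b + - (c + - d) ≡ 1ℤ * (a + - c) + -1ℤ * (b + - d)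
    identity = solve-∀

  -- The Leibniz rule for a product with a linear factor: second and higher differences of y ↦ y
  -- vanish, so two terms survive.
  Δ-leibniz : ∀ m f x → Δ (suc m) (λ y → + y * f y) x ≡ + x * Δ (suc m) f x + + suc m * Δ m f (suc x)
  Δ-leibniz zero    f x = identity (+ x) (f (suc x)) (f x)
    where
    identity : ∀ x a b → (1ℤ + x) * a + - (x * b) ≡ x * (a + - b) + 1ℤ * a
    identity = solve-∀
  Δ-leibniz (suc m) f x = trans
    (cong₂ (λ y z → y + - z) (Δ-leibniz m f (suc x)) (Δ-leibniz m f x))
    (identity (+ x) (+ m) (Δ m f (suc (suc x))) (Δ m f (suc x)) (Δ m f x))
    where
    identity : ∀ x m a b c →
      (1ℤ + x) * (a + - b) + (1ℤ + m) * a + - (x * (b + - c) + (1ℤ + m) * b) ≡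
      x * (a + - b + - (b + - c)) + (1ℤ + (1ℤ + m)) * (a + - b)
    identity = solve-∀

  -- The n-th difference of y^n does not depend on x, so in the Leibniz rule the term with the
  -- factor x cancels and n! grows by one factor.
  Δ-power : ∀ n x → Δ n (λ y → (+ y) ^ n) x ≡ ∏ n λ i → + suc i
  Δ-power zero    x = refl
  Δ-power (suc n) x = begin
    Δ (suc n) (λ y → + y * (+ y) ^ n) x
      ≡⟨ Δ-leibniz n (λ y → (+ y) ^ n) x ⟩
    + x * (Δ n _ (suc x) + - Δ n _ x) + + suc n * Δ n _ (suc x)
      ≡⟨ cong₂ (λ a b → + x * (a + - b) + + suc n * a) (Δ-power n (suc x)) (Δ-power n x) ⟩
    + x * (F + - F) + + suc n * F
      ≡⟨ identity (+ x) (+ suc n) F ⟩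
    F * + suc n ∎
    where
    open ≡-Reasoning
    F = ∏ n λ i → + suc i
    identity : ∀ x n F → x * (F + - F) + n * F ≡ F * n
    identity = solve-∀

  -- By Fermat this is the residue of y^(p-1) modulo p for 0 ≤ y < p.
  nonzero : ℕ → ℤ
  nonzero zero    = 0ℤ
  nonzero (suc _) = 1ℤ

  Δ-nonzero-suc : ∀ m x → Δ (suc m) nonzero (suc x) ≡ 0ℤ
  Δ-nonzero-suc zero    x = refl
  Δ-nonzero-suc (suc m) x = cong₂ (λ a b → a + - b) (Δ-nonzero-suc m (suc x)) (Δ-nonzero-suc m x)

  Δ-nonzero : ∀ m → Δ (suc m) nonzero 0 ≡ -1ℤ ^ m
  Δ-nonzero zero    = refl
  Δ-nonzero (suc m) = trans (cong₂ (λ a b → a + - b) (Δ-nonzero-suc m 0) (Δ-nonzero m)) (identity (-1ℤ ^ m))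
    where
    identity : ∀ z → 0ℤ + - z ≡ -1ℤ * z
    identity = solve-∀

  -- Factorials and parity

  ∏-suc≡! : ∀ n → ∏ n (λ i → + suc i) ≡ + (n !)
  ∏-suc≡! zero    = refl
  ∏-suc≡! (suc n) = trans (cong (_* + suc n) (∏-suc≡! n)) (trans (ℤ.*-comm (+ (n !)) (+ suc n)) (sym (ℤ.pos-* (suc n) (n !))))

  parity : ∀ n → (∃ λ m → n ≡ m ℕ.+ m) ⊎ (∃ λ m → n ≡ suc (m ℕ.+ m))
  parity zero    = inj₁ (0 , refl)
  parity (suc n) with parity n
  ... | inj₁ (m , eq) = inj₂ (m , cong suc eq)
  ... | inj₂ (m , eq) = inj₁ (suc m , trans (cong suc eq) (cong suc (sym (ℕ.+-suc m m))))

  -1^even : ∀ m → -1ℤ ^ (m ℕ.+ m) ≡ 1ℤ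
  -1^even m = trans (ℤ.^-distribˡ-+-* -1ℤ m m) (-1^n*-1^n≡1 m)

  -- The WZ pair

  -- Opaque, so that the arguments of a monomial can be inferred.
  opaque

    monomial : (E L O₁ O₂ I f₁ f₂ : ℤ) → ℤ
    monomial E L O₁ O₂ I f₁ f₂ = E * L * (O₁ * O₂) * (I * I) * (f₁ * f₁) * f₂

    monomial-cong : ∀ {E L O₁ O₁′ O₂ O₂′ I I′ f₁ f₁′ f₂ f₂′ q} →
      O₁ ≅ O₁′ ⟨mod q ⟩ → O₂ ≅ O₂′ ⟨mod q ⟩ → I ≅ I′ ⟨mod q ⟩ →
      f₁ ≅ f₁′ ⟨mod q ⟩ → f₂ ≅ f₂′ ⟨mod q ⟩ →
      monomial E L O₁ O₂ I f₁ f₂ ≅ monomial E L O₁′ O₂′ I′ f₁′ f₂′ ⟨mod q ⟩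
    monomial-cong {E} {L} ≅O₁ ≅O₂ ≅I ≅f₁ ≅f₂ =
      *-cong-≅ (*-cong-≅ (*-cong-≅ (*-congˡ-≅ (E * L) (*-cong-≅ ≅O₁ ≅O₂)) (*-cong-≅ ≅I ≅I)) (*-cong-≅ ≅f₁ ≅f₁)) ≅f₂

    -- It rests on (18k + 3)(2k + 1) = (6k + 1)(6k + 3), the two factors that extend `odd` from 3k
    -- to 3k + 2.
    wz-boundary-identity : ∀ k G O₁ O₂ I f →
      monomial (1ℤ * G) (+ 18 * k + + 20 * 0ℤ + + 3) O₁ O₂ ((1ℤ + (k + k)) * I) f 1ℤ ≡
      monomial (1ℤ * G) 1ℤ (O₁ * (1ℤ + (k + k))) (O₂ * (1ℤ + ((k + k + k) + (k + k + k))) * (1ℤ + (1ℤ + (k + k + k) + (1ℤ + (k + k + k))))) I f 1ℤ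
    wz-boundary-identity k G O₁ O₂ I f = identity k G O₁ O₂ I f
      where
      identity : ∀ k G O₁ O₂ I f →
        (1ℤ * G) * (+ 18 * k + + 20 * 0ℤ + + 3) * (O₁ * O₂) * (((1ℤ + (k + k)) * I) * ((1ℤ + (k + k)) * I)) * (f * f) * 1ℤ ≡
        (1ℤ * G) * 1ℤ * ((O₁ * (1ℤ + (k + k))) * (O₂ * (1ℤ + ((k + k + k) + (k + k + k))) * (1ℤ + (1ℤ + (k + k + k) + (1ℤ + (k + k + k)))))) * (I * I) * (f * f) * 1ℤ
      identity = solve-∀

    -- All reciprocals are first moved to their largest index, giving the common factors `I`, `f`
    -- and `f₂`. The four terms then differ by a polynomial multiple of 128 e + 1, so 128 e ≡ -1 is
    -- the only relation left to use.
    wz-step-identity : ∀ {q} e k j E Γ O₁ O₂ I f f₂ → + 128 * e ≅ -1ℤ ⟨mod q ⟩ →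
      monomial (e * E * Γ) (+ 18 * k + + 20 * (1ℤ + j) + + 3) O₁ O₂ ((1ℤ + (k + k)) * I) f f₂
      + monomial (E * Γ) 1ℤ O₁ O₂ I ((1ℤ + (k + j)) * f) ((1ℤ + j) * f₂) ≅
      monomial (E * (- + 2 * e * Γ)) (+ 18 * (1ℤ + k) + + 20 * j + + 3) O₁ (O₂ * (1ℤ + (((1ℤ + (k + j)) + (1ℤ + (k + j)) + k) + ((1ℤ + (k + j)) + (1ℤ + (k + j)) + k)))) I f ((1ℤ + j) * f₂)
      + monomial (e * E * Γ) 1ℤ (O₁ * (1ℤ + ((1ℤ + (k + j)) + (1ℤ + (k + j))))) (O₂ * (1ℤ + (((1ℤ + (k + j)) + (1ℤ + (k + j)) + k) + ((1ℤ + (k + j)) + (1ℤ + (k + j)) + k))) * (1ℤ + (1ℤ + ((1ℤ + (k + j)) + (1ℤ + (k + j)) + k) + (1ℤ + ((1ℤ + (k + j)) + (1ℤ + (k + j)) + k))))) I f f₂ ⟨mod q ⟩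
    wz-step-identity e k j E Γ O₁ O₂ I f f₂ =
      combination₁ ((1ℤ + (k + j)) * (1ℤ + (k + j)) * (1ℤ + j) * (E * Γ * (O₁ * O₂) * (I * I) * (f * f) * f₂))
        (identity e k j E Γ O₁ O₂ I f f₂)
      where
      identity : ∀ e k j E Γ O₁ O₂ I f f₂ →
        (e * E * Γ) * (+ 18 * k + + 20 * (1ℤ + j) + + 3) * (O₁ * O₂) * (((1ℤ + (k + k)) * I) * ((1ℤ + (k + k)) * I)) * (f * f) * f₂
        + (E * Γ) * 1ℤ * (O₁ * O₂) * (I * I) * (((1ℤ + (k + j)) * f) * ((1ℤ + (k + j)) * f)) * ((1ℤ + j) * f₂)
        + - ((E * (- + 2 * e * Γ)) * (+ 18 * (1ℤ + k) + + 20 * j + + 3) * (O₁ * (O₂ * (1ℤ + (((1ℤ + (k + j)) + (1ℤ + (k + j)) + k) + ((1ℤ + (k + j)) + (1ℤ + (k + j)) + k))))) * (I * I) * (f * f) * ((1ℤ + j) * f₂)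
          + (e * E * Γ) * 1ℤ * ((O₁ * (1ℤ + ((1ℤ + (k + j)) + (1ℤ + (k + j))))) * (O₂ * (1ℤ + (((1ℤ + (k + j)) + (1ℤ + (k + j)) + k) + ((1ℤ + (k + j)) + (1ℤ + (k + j)) + k))) * (1ℤ + (1ℤ + ((1ℤ + (k + j)) + (1ℤ + (k + j)) + k) + (1ℤ + ((1ℤ + (k + j)) + (1ℤ + (k + j)) + k)))))) * (I * I) * (f * f) * f₂) ≡
        (1ℤ + (k + j)) * (1ℤ + (k + j)) * (1ℤ + j) * (E * Γ * (O₁ * O₂) * (I * I) * (f * f) * f₂) * (+ 128 * e + - -1ℤ)
      identity = solve-∀

    wz-ratio-identity : ∀ e j m E Γ O₁ O₂ I a f f₂ →
      monomial (e * E * (- + 2 * e * Γ)) 1ℤ O₁ (O₂ * (1ℤ + (m + m))) (I * a) f ((+ 2 + j) * f₂) ≡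
      - + 2 * (+ 2 + j) * (1ℤ + (m + m)) * (a * a) * monomial (e * (e * E) * Γ) 1ℤ O₁ O₂ I f f₂
    wz-ratio-identity e j m E Γ O₁ O₂ I a f f₂ = identity e j m E Γ O₁ O₂ I a f f₂
      where
      identity : ∀ e j m E Γ O₁ O₂ I a f f₂ →
        e * E * (- + 2 * e * Γ) * 1ℤ * (O₁ * (O₂ * (1ℤ + (m + m)))) * (I * a * (I * a)) * (f * f) * ((+ 2 + j) * f₂) ≡
        - + 2 * (+ 2 + j) * (1ℤ + (m + m)) * (a * a) * (e * (e * E) * Γ * 1ℤ * (O₁ * O₂) * (I * I) * (f * f) * f₂)
      identity = solve-∀

    wz-initial-identity : ∀ E P w w′ F X Y a f →
      monomial (E * 1ℤ) 1ℤ (w′ * F * Y * P) (w′ * F * Y * (P * (w * F * X)) * (1ℤ + + 2 * P)) a f f ≡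
      P * (P * (E * w′ * w′ * w * (Y * Y))) * X * (1ℤ + + 2 * P) * (a * a) * (F * f * (F * f) * (F * f))
    wz-initial-identity E P w w′ F X Y a f = identity E P w w′ F X Y a f
      where
      identity : ∀ E P w w′ F X Y a f →
        E * 1ℤ * 1ℤ * (w′ * F * Y * P * (w′ * F * Y * (P * (w * F * X)) * (1ℤ + + 2 * P))) * (a * a) * (f * f) * f ≡
        P * (P * (E * w′ * w′ * w * (Y * Y))) * X * (1ℤ + + 2 * P) * (a * a) * (F * f * (F * f) * (F * f))
      identity = solve-∀

    -- Here 18N + 3 = 3 (6N + 1), and 6N + 1 = 3p - 2 completes the odd numbers below 3p. The 3 that
    -- remains is the leading constant of the result.
    wz-final-identity : ∀ Γ N O₁ O₂ I f →
      monomial (1ℤ * Γ) (+ 18 * N + + 20 * 0ℤ + + 3) O₁ O₂ I f 1ℤ ≡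
      + 3 * Γ * (O₂ * (1ℤ + (N + N + N + (N + N + N)))) * (O₁ * I) * I * (f * f)
    wz-final-identity Γ N O₁ O₂ I f = identity Γ N O₁ O₂ I f
      where
      identity : ∀ Γ N O₁ O₂ I f →
        1ℤ * Γ * (+ 18 * N + + 20 * 0ℤ + + 3) * (O₁ * O₂) * (I * I) * (f * f) * 1ℤ ≡
        + 3 * Γ * (O₂ * (1ℤ + (N + N + N + (N + N + N)))) * (O₁ * I) * I * (f * f)
      identity = solve-∀

    wz-summand-identity : ∀ E k O₁ O₂ f →
      monomial (E * 1ℤ) (+ 18 * 0ℤ + + 20 * k + + 3) O₁ O₂ 1ℤ f f ≡ E * (+ 20 * k + + 3) * O₁ * O₂ * (f * f * f)
    wz-summand-identity E k O₁ O₂ f = identity E k O₁ O₂ f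
      where
      identity : ∀ E k O₁ O₂ f →
        E * 1ℤ * (+ 18 * 0ℤ + + 20 * k + + 3) * (O₁ * O₂) * (1ℤ * 1ℤ) * (f * f) * f ≡ E * (+ 20 * k + + 3) * O₁ * O₂ * (f * f * f)
      identity = solve-∀

  -- Reciprocals modulo powers of p and the reflection i ↦ p - i

  module ModPrime (N : ℕ) (p-prime : Prime (suc (N ℕ.+ N))) (3<p : 3 < suc (N ℕ.+ N)) where

    p : ℕ
    p = suc (N ℕ.+ N)

    P : ℤ
    P = + p

    v : ℕ → ℤ
    v = recip p-prime

    v-inverse : ∀ i → ¬ p ℕ.∣ i → + i * v i ≅ 1ℤ ⟨mod P ^ 4 ⟩
    v-inverse = recip-inverse p-prime

    4→2 : ∀ {a b} → a ≅ b ⟨mod P ^ 4 ⟩ → a ≅ b ⟨mod P ^ 2 ⟩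
    4→2 e = weaken-≅ P (weaken-≅ P e)

    2→1 : ∀ {a b} → a ≅ b ⟨mod P ^ 2 ⟩ → a ≅ b ⟨mod P ⟩
    2→1 {a} {b} e = subst (a ≅ b ⟨mod_⟩) (ℤ.*-identityʳ P) (weaken-≅ P e)

    4→1 : ∀ {a b} → a ≅ b ⟨mod P ^ 4 ⟩ → a ≅ b ⟨mod P ⟩
    4→1 e = 2→1 (4→2 e)

    q≅0 : ∀ {q} → q ≅ 0ℤ ⟨mod q ⟩
    q≅0 {q} = modulo 1ℤ (trans (sym (ℤ.*-identityˡ q)) (sym (ℤ.+-identityˡ _)))

    a b c : ℕ → ℤ
    a j = v (suc (j ℕ.+ j))
    b i = v (suc (suc (i ℕ.+ i)))
    c i = v (suc i)

    ∤-<p : ∀ {i} → suc i ≤ N ℕ.+ N → ¬ p ℕ.∣ suc i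
    ∤-<p i≤ = <⇒∤ p-prime (s≤s i≤)

    suc-double-≤ : ∀ {i} → i < N → suc (suc (i ℕ.+ i)) ≤ N ℕ.+ N
    suc-double-≤ {i} i<N = subst (_≤ N ℕ.+ N) (cong suc (ℕ.+-suc i i)) (ℕ.+-mono-≤ i<N i<N)

    a-inverse : ∀ j → j < N → + suc (j ℕ.+ j) * a j ≅ 1ℤ ⟨mod P ^ 4 ⟩
    a-inverse j j<N = v-inverse _ (∤-<p (ℕ.<⇒≤ (suc-double-≤ j<N)))

    b-inverse : ∀ i → i < N → + suc (suc (i ℕ.+ i)) * b i ≅ 1ℤ ⟨mod P ^ 4 ⟩
    b-inverse i i<N = v-inverse _ (∤-<p (suc-double-≤ i<N))

    c-inverse : ∀ i → i < N ℕ.+ N → + suc i * c i ≅ 1ℤ ⟨mod P ^ 4 ⟩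
    c-inverse i i<2N = v-inverse _ (∤-<p i<2N)

    -- Since p is odd, the reflection exchanges parities. This is how products and sums over odd
    -- numbers become products and sums over 2 (i + 1).
    odd-reflection : ∀ i j → suc (i ℕ.+ j) ≡ N → + suc (j ℕ.+ j) ≡ P + - + suc (suc (i ℕ.+ i))
    odd-reflection i j refl = identity (+ i) (+ j)
      where
      identity : ∀ i j → 1ℤ + (j + j) ≡ 1ℤ + (1ℤ + (i + j) + (1ℤ + (i + j))) + - (+ 2 + (i + i))
      identity = solve-∀

    upper-reflection : ∀ i j → suc (i ℕ.+ j) ≡ N → + suc (N ℕ.+ j) ≡ P + - + suc i
    upper-reflection i j refl = identity (+ i) (+ j)
      where
      identity : ∀ i j → 1ℤ + (1ℤ + (i + j) + j) ≡ 1ℤ + (1ℤ + (i + j) + (1ℤ + (i + j))) + - (1ℤ + i)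
      identity = solve-∀

    reflectˡ : ∀ i j → suc (i ℕ.+ j) ≡ N → i < N
    reflectˡ i j refl = s≤s (ℕ.m≤m+n i j)

    reflectʳ : ∀ i j → suc (i ℕ.+ j) ≡ N → j < N
    reflectʳ i j refl = s≤s (ℕ.m≤n+m j i)

    -- The geometric series 1/(q - D) = -(1/D)(1 + q/D + ...) cut off modulo q², which is spelled
    -- out as `q ^ 2` unfolds.
    inverse-of-difference : ∀ D {J} x y q → J ≡ q + - D →
      J * x ≅ 1ℤ ⟨mod q * (q * 1ℤ) ⟩ → D * y ≅ 1ℤ ⟨mod q * (q * 1ℤ) ⟩ →
      x ≅ - (y + q * (y * y)) ⟨mod q * (q * 1ℤ) ⟩
    inverse-of-difference D x y q refl e₁ e₂ =
      combination₃ (- y * (1ℤ + q * y)) (- x * (1ℤ + q * y)) (x * (y * y))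
        (identity D x y q) e₁ e₂ q≅0
      where
      identity : ∀ D x y q → x + - - (y + q * (y * y)) ≡
        - y * (1ℤ + q * y) * ((q + - D) * x + - 1ℤ) + - x * (1ℤ + q * y) * (D * y + - 1ℤ)
        + x * (y * y) * (q * (q * 1ℤ) + - 0ℤ)
      identity = solve-∀

    a≅-b : ∀ i j → suc (i ℕ.+ j) ≡ N → a j ≅ - (b i + P * (b i * b i)) ⟨mod P ^ 2 ⟩
    a≅-b i j eq = inverse-of-difference (+ suc (suc (i ℕ.+ i))) (a j) (b i) P (odd-reflection i j eq)
      (4→2 (a-inverse j (reflectʳ i j eq))) (4→2 (b-inverse i (reflectˡ i j eq)))

    drop-P : ∀ x y z → x ≅ - (y + P * z) ⟨mod P ^ 2 ⟩ → x ≅ - y ⟨mod P ⟩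
    drop-P x y z e = combination₂ 1ℤ (- z) (identity x y z P) (2→1 e) q≅0
      where
      identity : ∀ x y z P → x + - - y ≡ 1ℤ * (x + - - (y + P * z)) + - z * (P + - 0ℤ)
      identity = solve-∀

    square-neg : ∀ x y → x ≅ - y ⟨mod P ⟩ → x * x ≅ y * y ⟨mod P ⟩
    square-neg x y e = combination₁ (x + - y) (identity x y) e
      where
      identity : ∀ x y → x * x + - (y * y) ≡ (x + - y) * (x + - - y)
      identity = solve-∀

    B O B² A² : ℤ
    B  = ∑ N b
    O  = ∑ N a
    B² = ∑ N λ i → b i * b i
    A² = ∑ N λ j → a j * a j

    A²≅B² : A² ≅ B² ⟨mod P ⟩
    A²≅B² = ≅-sym (∑≅.fold-reverse P N λ i j eq → ≅-sym (square-neg (a j) (b i) (drop-P (a j) (b i) (b i * b i) (a≅-b i j eq))))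

    c≅2b : ∀ i → i < N → c i ≅ + 2 * b i ⟨mod P ^ 4 ⟩
    c≅2b i i<N = combination₂ (- (c i)) (+ 2 * b i) (identity (+ i) (b i) (c i))
      (b-inverse i i<N) (c-inverse i (ℕ.<-≤-trans i<N (ℕ.m≤m+n N N)))
      where
      identity : ∀ i b c → c + - (+ 2 * b) ≡
        - c * ((+ 2 + (i + i)) * b + - 1ℤ) + + 2 * b * ((1ℤ + i) * c + - 1ℤ)
      identity = solve-∀

    upper-c≅-c : ∀ i j → suc (i ℕ.+ j) ≡ N → c (N ℕ.+ j) ≅ - c i ⟨mod P ⟩
    upper-c≅-c i j eq = drop-P (c (N ℕ.+ j)) (c i) (c i * c i) (inverse-of-difference (+ suc i) (c (N ℕ.+ j)) (c i) P (upper-reflection i j eq)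
      (4→2 (c-inverse (N ℕ.+ j) (ℕ.+-monoʳ-< N (reflectʳ i j eq))))
      (4→2 (c-inverse i (ℕ.<-≤-trans (reflectˡ i j eq) (ℕ.m≤m+n N N)))))

    p∤2 : ¬ p ℕ.∣ 2
    p∤2 = <⇒∤ p-prime (ℕ.<-trans (s≤s (s≤s (s≤s z≤n))) 3<p)

    -- This is where `3 < p` is needed in full: equating two evaluations of ∑ 1/i² gives 8 `B²` ≡ 2
    -- `B²`, and the difference 6 has to be cancelled.
    p∤6 : ¬ p ℕ.∣ 6
    p∤6 = ∤-* p-prime 2 3 p∤2 (<⇒∤ p-prime 3<p)

    -- Twice ∑ 1/i² over 0 < i < p, split by parity and split by the reflection i ↦ p - i.
    B²≅0 : B² ≅ 0ℤ ⟨mod P ⟩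
    B²≅0 = cancel-≅ {u = + 6} (4→1 (v-inverse 6 p∤6)) (begin
      + 6 * B²                         ≡⟨ split B² ⟩
      + 4 * B² + + 4 * B² + - (B² + B²)
        ≈⟨ +-cong-≅ (≅-sym reflected) (combination₁ -1ℤ (negate (A² + B²) (B² + B²)) (+-cong-≅ (≅-sym A²≅B²) (≅-refl {B²}))) ⟩
      ∑ (N ℕ.+ N) c² + - (A² + B²)     ≈⟨ +-cong-≅ by-parity ≅-refl ⟩
      A² + B² + - (A² + B²)            ≡⟨ ℤ.+-inverseʳ (A² + B²) ⟩
      0ℤ                               ≡⟨⟩
      + 6 * 0ℤ                         ∎)
      where
      open ≅-Reasoning P
      c² : ℕ → ℤ
      c² i = c i * c i
      split : ∀ x → + 6 * x ≡ + 4 * x + + 4 * x + - (x + x)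
      split = solve-∀
      negate : ∀ x y → - y + - - x ≡ -1ℤ * (y + - x)
      negate = solve-∀
      by-parity : ∑ (N ℕ.+ N) c² ≅ A² + B² ⟨mod P ⟩
      by-parity = ≅-trans (∑≅.fold-pairs P N c²) (∑≅.fold-∙ P N _ _)
      c²≅4b² : ∀ i → i < N → c² i ≅ + 4 * (b i * b i) ⟨mod P ⟩
      c²≅4b² i i<N = ≅-trans (*-cong-≅ (4→1 (c≅2b i i<N)) (4→1 (c≅2b i i<N))) (≡⇒≅ (identity (b i)))
        where
        identity : ∀ b → + 2 * b * (+ 2 * b) ≡ + 4 * (b * b)
        identity = solve-∀
      4B² : ∑ N (λ i → + 4 * (b i * b i)) ≅ + 4 * B² ⟨mod P ⟩
      4B² = ≡⇒≅ (∑-distribˡ N (+ 4) _)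
      lower : ∑ N c² ≅ + 4 * B² ⟨mod P ⟩
      lower = ≅-trans (∑≅.fold-cong P N c²≅4b²) 4B²
      upper : ∑ N (λ j → c² (N ℕ.+ j)) ≅ + 4 * B² ⟨mod P ⟩
      upper = ≅-trans (≅-sym (∑≅.fold-reverse P N λ i j eq → ≅-sym (square-neg (c (N ℕ.+ j)) (c i) (upper-c≅-c i j eq)))) lower
      reflected : ∑ (N ℕ.+ N) c² ≅ + 4 * B² + + 4 * B² ⟨mod P ⟩
      reflected = ≅-trans (∑≅.fold-++ P N N c²) (+-cong-≅ lower upper)

    A²≅0 : A² ≅ 0ℤ ⟨mod P ⟩
    A²≅0 = ≅-trans A²≅B² B²≅0

    P*≅0 : ∀ {x} → x ≅ 0ℤ ⟨mod P ⟩ → P * x ≅ 0ℤ ⟨mod P ^ 2 ⟩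
    P*≅0 {x} e = ≅-trans (subst (P * x ≅ P * 0ℤ ⟨mod_⟩) (cong (P *_) (sym (ℤ.*-identityʳ P))) (scale-≅ P e)) (≡⇒≅ (ℤ.*-zeroʳ P))

    -- Reflection gives each term only up to a correction p/(2i)²; these corrections add up to p
    -- `B²`, which vanishes modulo p².
    O≅-B : O ≅ - B ⟨mod P ^ 2 ⟩
    O≅-B = begin
      O                                     ≈⟨ ∑≅.fold-reverse (P ^ 2) N (λ i j eq → ≅-sym (a≅-b i j eq)) ⟨
      ∑ N (λ i → - (b i + P * (b i * b i))) ≡⟨ collect N ⟩
      - (B + P * B²)                        ≈⟨ combination₁ -1ℤ (identity B P B²) (P*≅0 B²≅0) ⟩
      - B                                   ∎
      where
      open ≅-Reasoning (P ^ 2)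
      identity : ∀ x P y → - (x + P * y) + - - x ≡ -1ℤ * (P * y + - 0ℤ)
      identity = solve-∀
      step : ∀ x y P z → - (x + P * y) + - (z + P * (z * z)) ≡ - (x + z + P * (y + z * z))
      step = solve-∀
      collect : ∀ n → ∑ n (λ i → - (b i + P * (b i * b i))) ≡ - (∑ n b + P * ∑ n (λ i → b i * b i))
      collect zero    = sym (cong (λ z → - (0ℤ + z)) (ℤ.*-zeroʳ P))
      collect (suc n) = trans (cong (_+ - (b n + P * (b n * b n))) (collect n)) (step (∑ n b) _ P (b n))

    -- Expansions modulo p³

    mod¹ : ∀ {x y} → x ≅ y ⟨mod P ⟩ → x ≅ y ⟨mod P ^ 1 ⟩
    mod¹ {x} {y} = subst (x ≅ y ⟨mod_⟩) (sym (ℤ.*-identityʳ P))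

    -- `h` is 1/2 and `y` is x²/2. Keeping `y` as a separate letter lets products of `ε` reduce by
    -- the three rules `xx≅2y`, `xy≅0` and `yy≅0`.
    h x y : ℤ
    h = v 2
    x = P * B
    y = h * (x * x)

    h-inverse : + 2 * h ≅ 1ℤ ⟨mod P ^ 4 ⟩
    h-inverse = v-inverse 2 p∤2

    X ε : ℤ → ℤ
    X s = ∏ N λ i → 1ℤ + s * (P * b i)
    ε s = 1ℤ + s * x + s * s * y

    -- The r-th elementary symmetric sum carries the factor p^r, so only r ≤ 2 survives modulo p³.
    ∏-expansion : ∀ f s n → ∏ n (λ i → 1ℤ + s * (P * f i)) ≅
      1ℤ + s * (P * ∑ n f) + s * s * (P * (P * ∑-of-products f n)) ⟨mod P ^ 3 ⟩
    ∏-expansion f s zero    = ≡⇒≅ (identity s P)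
      where
      identity : ∀ s P → 1ℤ ≡ 1ℤ + s * (P * 0ℤ) + s * s * (P * (P * 0ℤ))
      identity = solve-∀
    ∏-expansion f s (suc n) = combination₂ (1ℤ + s * (P * f n)) (s * s * s * (f n * ∑-of-products f n))
      (identity s P (∏ n λ i → 1ℤ + s * (P * f i)) (∑ n f) (∑-of-products f n) (f n)) (∏-expansion f s n) q≅0
      where
      identity : ∀ s P Π S E t →
        Π * (1ℤ + s * (P * t)) + - (1ℤ + s * (P * (S + t)) + s * s * (P * (P * (E + t * S)))) ≡
        (1ℤ + s * (P * t)) * (Π + - (1ℤ + s * (P * S) + s * s * (P * (P * E))))
        + s * s * s * (t * E) * (P * (P * (P * 1ℤ)) + - 0ℤ)
      identity = solve-∀

    -- The quadratic coefficient e₁²/2 of an exponential. It serves the even reciprocals `b` here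
    -- and the odd reciprocals `a` in the sum of `τ`.
    ∑-of-products≅ : ∀ f n → ∑ n (λ i → f i * f i) ≅ 0ℤ ⟨mod P ⟩ →
      ∑-of-products f n ≅ h * (∑ n f * ∑ n f) ⟨mod P ⟩
    ∑-of-products≅ f n e = ≅-trans
      (combination₂ (- E) (- h) (identity h E (∑ n λ i → f i * f i)) (4→1 h-inverse) e)
      (≡⇒≅ (cong (h *_) (sym (square-of-∑ f n))))
      where
      E = ∑-of-products f n
      identity : ∀ h E R → E + - (h * (E + E + R)) ≡ - E * (+ 2 * h + - 1ℤ) + - h * (R + - 0ℤ)
      identity = solve-∀

    X≅ε : ∀ s → X s ≅ ε s ⟨mod P ^ 3 ⟩
    X≅ε s = ≅-trans (∏-expansion b s N)
      (combination₁ (s * s) (identity s P B (∑-of-products b N) h)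
        (scale-≅ P (scale-≅ P (mod¹ (∑-of-products≅ b N B²≅0)))))
      where
      identity : ∀ s P B E h →
        1ℤ + s * (P * B) + s * s * (P * (P * E)) + - (1ℤ + s * (P * B) + s * s * (h * (P * B * (P * B)))) ≡
        s * s * (P * (P * E) + - (P * (P * (h * (B * B)))))
      identity = solve-∀

    xx≅2y : x * x ≅ y + y ⟨mod P ^ 3 ⟩
    xx≅2y = combination₁ (- (x * x)) (identity x h) (weaken-≅ P h-inverse)
      where
      identity : ∀ x h → x * x + - (h * (x * x) + h * (x * x)) ≡ - (x * x) * (+ 2 * h + - 1ℤ)
      identity = solve-∀

    xy≅0 : x * y ≅ 0ℤ ⟨mod P ^ 3 ⟩
    xy≅0 = modulo (h * (B * B * B)) (identity P B h)
      where
      identity : ∀ P B h → P * B * (h * (P * B * (P * B))) ≡ 0ℤ + h * (B * B * B) * (P * (P * (P * 1ℤ)))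
      identity = solve-∀

    yy≅0 : y * y ≅ 0ℤ ⟨mod P ^ 3 ⟩
    yy≅0 = ≅-trans (≡⇒≅ (identity x h)) (≅-trans (*-congˡ-≅ (h * x) xy≅0) (≡⇒≅ (ℤ.*-zeroʳ (h * x))))
      where
      identity : ∀ x h → h * (x * x) * (h * (x * x)) ≡ h * x * (x * (h * (x * x)))
      identity = solve-∀

    -- ε is a truncated exponential.
    ε-* : ∀ r s → ε r * ε s ≅ ε (r + s) ⟨mod P ^ 3 ⟩
    ε-* r s = combination₃ (r * s) (r * s * s + r * r * s) (r * r * (s * s))
      (identity r s x y) xx≅2y xy≅0 yy≅0
      where
      identity : ∀ r s x y →
        (1ℤ + r * x + r * r * y) * (1ℤ + s * x + s * s * y) + - (1ℤ + (r + s) * x + (r + s) * (r + s) * y) ≡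
        r * s * (x * x + - (y + y)) + (r * s * s + r * r * s) * (x * y + - 0ℤ) + r * r * (s * s) * (y * y + - 0ℤ)
      identity = solve-∀

    -- Factorials and odd products as values of X

    F IF : ℤ
    F  = ∏ N λ i → + suc i
    IF = ∏ N c

    factorial-inverse : ∀ n → n ≤ N → ∏ n (λ i → + suc i) * ∏ n c ≅ 1ℤ ⟨mod P ^ 4 ⟩
    factorial-inverse n n≤N = begin
      ∏ n (λ i → + suc i) * ∏ n c ≈⟨ ∏≅.fold-∙ (P ^ 4) n _ c ⟨
      ∏ n (λ i → + suc i * c i)   ≈⟨ ∏≅.fold-cong (P ^ 4) n (λ i i<n → c-inverse i (ℕ.<-≤-trans i<n (ℕ.≤-trans n≤N (ℕ.m≤m+n N N)))) ⟩
      ∏ n (λ i → 1ℤ)              ≡⟨ trans (∏-const n 1ℤ) (ℤ.^-zeroˡ n) ⟩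
      1ℤ                          ∎
      where open ≅-Reasoning (P ^ 4)

    F-inverse : F * IF ≅ 1ℤ ⟨mod P ^ 4 ⟩
    F-inverse = factorial-inverse N ℕ.≤-refl

    ∏-scaled : ∀ u s → ∏ N (λ i → u * + suc i * (1ℤ + s * (P * b i))) ≡ u ^ N * F * X s
    ∏-scaled u s = trans (∏≡.fold-∙ N (λ i → u * + suc i) (λ i → 1ℤ + s * (P * b i)))
      (cong (_* X s) (trans (∏≡.fold-∙ N (λ _ → u) (λ i → + suc i)) (cong (_* F) (∏-const N u))))

    -- Each odd number below p is p - 2(i+1) = -2(i+1) (1 - p/(2(i+1))).
    odd-N : odd N ≅ (- + 2) ^ N * F * X -1ℤ ⟨mod P ^ 4 ⟩
    odd-N = ≅-trans (≅-sym (∏≅.fold-reverse (P ^ 4) N pointwise)) (≡⇒≅ (∏-scaled (- + 2) -1ℤ))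
      where
      identity : ∀ i P b → - + 2 * (1ℤ + i) * (1ℤ + -1ℤ * (P * b)) + - (P + - (+ 2 + (i + i))) ≡
        P * ((+ 2 + (i + i)) * b + - 1ℤ)
      identity = solve-∀
      pointwise : ∀ i j → suc (i ℕ.+ j) ≡ N →
        - + 2 * + suc i * (1ℤ + -1ℤ * (P * b i)) ≅ + suc (j ℕ.+ j) ⟨mod P ^ 4 ⟩
      pointwise i j eq = ≅-trans (combination₁ P (identity (+ i) P (b i)) (b-inverse i (reflectˡ i j eq)))
        (≡⇒≅ (sym (odd-reflection i j eq)))

    -- The factors are p - (i+1), and p/(i+1) is twice p/(2(i+1)); hence the argument -2.
    upper-N : ∏ N (λ j → + suc (N ℕ.+ j)) ≅ -1ℤ ^ N * F * X (- + 2) ⟨mod P ^ 4 ⟩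
    upper-N = ≅-trans (≅-sym (∏≅.fold-reverse (P ^ 4) N pointwise)) (≡⇒≅ (∏-scaled -1ℤ (- + 2)))
      where
      identity : ∀ i P b → -1ℤ * (1ℤ + i) * (1ℤ + - + 2 * (P * b)) + - (P + - (1ℤ + i)) ≡
        P * ((+ 2 + (i + i)) * b + - 1ℤ)
      identity = solve-∀
      pointwise : ∀ i j → suc (i ℕ.+ j) ≡ N →
        -1ℤ * + suc i * (1ℤ + - + 2 * (P * b i)) ≅ + suc (N ℕ.+ j) ⟨mod P ^ 4 ⟩
      pointwise i j eq = ≅-trans (combination₁ P (identity (+ i) P (b i)) (b-inverse i (reflectˡ i j eq)))
        (≡⇒≅ (sym (upper-reflection i j eq)))

    odds-above-p : ∏ N (λ i → + suc (N ℕ.+ suc i ℕ.+ (N ℕ.+ suc i))) ≅ (+ 2) ^ N * F * X 1ℤ ⟨mod P ^ 4 ⟩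
    odds-above-p = ≅-trans (∏≅.fold-cong (P ^ 4) N pointwise) (≡⇒≅ (∏-scaled (+ 2) 1ℤ))
      where
      identity : ∀ i N b → 1ℤ + (N + (1ℤ + i) + (N + (1ℤ + i))) + - (+ 2 * (1ℤ + i) * (1ℤ + 1ℤ * ((1ℤ + (N + N)) * b))) ≡
        - (1ℤ + (N + N)) * ((+ 2 + (i + i)) * b + - 1ℤ)
      identity = solve-∀
      pointwise : ∀ i → i < N → + suc (N ℕ.+ suc i ℕ.+ (N ℕ.+ suc i)) ≅
        + 2 * + suc i * (1ℤ + 1ℤ * (P * b i)) ⟨mod P ^ 4 ⟩
      pointwise i i<N = combination₁ (- P) (identity (+ i) (+ N) (b i)) (b-inverse i i<N)

    -- The factors are 3p - 2(i+1) in increasing order, so they are read backwards.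
    odds-below-3p : ∏ N (λ j → + suc (N ℕ.+ suc (N ℕ.+ j) ℕ.+ (N ℕ.+ suc (N ℕ.+ j)))) ≅
      (- + 2) ^ N * F * X (- + 3) ⟨mod P ^ 4 ⟩
    odds-below-3p = ≅-trans (≅-sym (∏≅.fold-reverse (P ^ 4) N pointwise)) (≡⇒≅ (∏-scaled (- + 2) (- + 3)))
      where
      identity : ∀ i P b → - + 2 * (1ℤ + i) * (1ℤ + - + 3 * (P * b)) + - (P + + 2 * (P + - (1ℤ + i))) ≡
        + 3 * P * ((+ 2 + (i + i)) * b + - 1ℤ)
      identity = solve-∀
      shape : ∀ N s → 1ℤ + (N + s + (N + s)) ≡ 1ℤ + (N + N) + + 2 * s
      shape = solve-∀
      pointwise : ∀ i j → suc (i ℕ.+ j) ≡ N →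
        - + 2 * + suc i * (1ℤ + - + 3 * (P * b i)) ≅ + suc (N ℕ.+ suc (N ℕ.+ j) ℕ.+ (N ℕ.+ suc (N ℕ.+ j))) ⟨mod P ^ 4 ⟩
      pointwise i j eq = ≅-trans (combination₁ (+ 3 * P) (identity (+ i) P (b i)) (b-inverse i (reflectˡ i j eq)))
        (≡⇒≅ (sym (trans (shape (+ N) (+ suc (N ℕ.+ j)))
          (cong (λ z → P + + 2 * z) (upper-reflection i j eq)))))

    t : ℤ
    t = (+ 4) ^ N

    factorial-split : odd N * ((+ 2) ^ N * F) ≡ F * ∏ N (λ j → + suc (N ℕ.+ j))
    factorial-split = trans (sym (∏-suc-double N)) (∏≡.fold-++ N N (λ i → + suc i))

    tX≅X : t * X -1ℤ ≅ X (- + 2) ⟨mod P ^ 4 ⟩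
    -- Both evaluations of (2N)! contain the unit (-1)^N (N!)², which is cancelled.
    tX≅X = cancel-≅ {a = t * X -1ℤ} {b = X (- + 2)} {u = σ * (F * F)} {v = σ * (IF * IF)} unit (begin
      σ * (F * F) * (t * X -1ℤ)                   ≡⟨ cong (λ z → σ * (F * F) * (z * X -1ℤ)) (^-*-swap (+ 2) (+ 2) N) ⟩
      σ * (F * F) * (2ᴺ * 2ᴺ * X -1ℤ)             ≡⟨ rearrange₁ σ F 2ᴺ (X -1ℤ) ⟩
      σ * 2ᴺ * F * X -1ℤ * (2ᴺ * F)               ≡⟨ cong (λ z → z * F * X -1ℤ * (2ᴺ * F)) (^-*-swap -1ℤ (+ 2) N) ⟨
      (- + 2) ^ N * F * X -1ℤ * (2ᴺ * F)          ≈⟨ *-cong-≅ odd-N ≅-refl ⟨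
      odd N * (2ᴺ * F)                            ≡⟨ factorial-split ⟩
      F * ∏ N (λ j → + suc (N ℕ.+ j))             ≈⟨ *-congˡ-≅ F upper-N ⟩
      F * (σ * F * X (- + 2))                     ≡⟨ rearrange₂ σ F (X (- + 2)) ⟩
      σ * (F * F) * X (- + 2)                     ∎)
      where
      open ≅-Reasoning (P ^ 4)
      σ = -1ℤ ^ N
      2ᴺ = (+ 2) ^ N
      rearrange₁ : ∀ σ F w X → σ * (F * F) * (w * w * X) ≡ σ * w * F * X * (w * F)
      rearrange₁ = solve-∀
      rearrange₂ : ∀ σ F X → F * (σ * F * X) ≡ σ * (F * F) * X
      rearrange₂ = solve-∀
      rearrange₃ : ∀ σ F G → σ * (F * F) * (σ * (G * G)) ≡ σ * σ * (F * G * (F * G))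
      rearrange₃ = solve-∀
      unit : σ * (F * F) * (σ * (IF * IF)) ≅ 1ℤ ⟨mod P ^ 4 ⟩
      unit = ≅-trans (≡⇒≅ (trans (rearrange₃ σ F IF) (cong (_* (F * IF * (F * IF))) (-1^n*-1^n≡1 N))))
        (*-congˡ-≅ 1ℤ (*-cong-≅ F-inverse F-inverse))

    ε-zero : ε 0ℤ ≡ 1ℤ
    ε-zero = identity x y
      where
      identity : ∀ x y → 1ℤ + 0ℤ * x + 0ℤ * 0ℤ * y ≡ 1ℤ
      identity = solve-∀

    -- `ε 1ℤ` inverts `ε -1ℤ`, so t exp(-x) = exp(-2x) can be solved for t.
    t≅ε : t ≅ ε -1ℤ ⟨mod P ^ 3 ⟩
    t≅ε = begin
      t                        ≡⟨ trans (sym (ℤ.*-identityʳ t)) (cong (t *_) (sym ε-zero)) ⟩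
      t * ε 0ℤ                 ≈⟨ *-congˡ-≅ t (ε-* -1ℤ 1ℤ) ⟨
      t * (ε -1ℤ * ε 1ℤ)       ≡⟨ ℤ.*-assoc t (ε -1ℤ) (ε 1ℤ) ⟨
      t * ε -1ℤ * ε 1ℤ         ≈⟨ *-cong-≅ (*-congˡ-≅ t (X≅ε -1ℤ)) ≅-refl ⟨
      t * X -1ℤ * ε 1ℤ         ≈⟨ *-cong-≅ (weaken-≅ P tX≅X) ≅-refl ⟩
      X (- + 2) * ε 1ℤ         ≈⟨ *-cong-≅ (X≅ε (- + 2)) ≅-refl ⟩
      ε (- + 2) * ε 1ℤ         ≈⟨ ε-* (- + 2) 1ℤ ⟩
      ε -1ℤ                    ∎
      where open ≅-Reasoning (P ^ 3)

    -- The sum of τ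

    U τ : ℕ → ℤ
    U k = X 1ℤ * ∏ k λ j → (1ℤ + - (P * a j)) * (1ℤ + + 2 * (P * a j))
    τ k = U k * (a k + + 2 * (P * (a k * a k)))

    U≅ : ∀ k → U k ≅ 1ℤ + P * (B + ∑ k a) ⟨mod P ^ 2 ⟩
    U≅ k = ≅-trans (*-cong-≅ X₁ (ratios k))
      (combination₁ (B * ∑ k a) (identity P B (∑ k a)) q≅0)
      where
      identity : ∀ P B S → (1ℤ + P * B) * (1ℤ + P * S) + - (1ℤ + P * (B + S)) ≡ B * S * (P * (P * 1ℤ) + - 0ℤ)
      identity = solve-∀
      truncate : ∀ P B h → 1ℤ + 1ℤ * (P * B) + 1ℤ * 1ℤ * (h * (P * B * (P * B))) + - (1ℤ + P * B) ≡
        h * (B * B) * (P * (P * 1ℤ) + - 0ℤ)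
      truncate = solve-∀
      X₁ : X 1ℤ ≅ 1ℤ + P * B ⟨mod P ^ 2 ⟩
      X₁ = ≅-trans (weaken-≅ P (X≅ε 1ℤ)) (combination₁ (h * (B * B)) (truncate P B h) q≅0)
      step : ∀ P Π S t → Π * ((1ℤ + - (P * t)) * (1ℤ + + 2 * (P * t))) + - (1ℤ + P * (S + t)) ≡
        (1ℤ + - (P * t)) * (1ℤ + + 2 * (P * t)) * (Π + - (1ℤ + P * S))
        + (S * t + - (+ 2 * (t * t)) + - (+ 2 * (P * S * t * t))) * (P * (P * 1ℤ) + - 0ℤ)
      step = solve-∀
      ratios : ∀ k → ∏ k (λ j → (1ℤ + - (P * a j)) * (1ℤ + + 2 * (P * a j))) ≅ 1ℤ + P * ∑ k a ⟨mod P ^ 2 ⟩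
      ratios zero    = ≡⇒≅ (cong (λ z → 1ℤ + z) (sym (ℤ.*-zeroʳ P)))
      ratios (suc k) = combination₂ ((1ℤ + - (P * a k)) * (1ℤ + + 2 * (P * a k)))
        (∑ k a * a k + - (+ 2 * (a k * a k)) + - (+ 2 * (P * ∑ k a * a k * a k)))
        (step P (∏ k λ j → (1ℤ + - (P * a j)) * (1ℤ + + 2 * (P * a j))) (∑ k a) (a k)) (ratios k) q≅0

    T : ℤ
    T = ∑ N τ

    -- Modulo p² the sum is `O` + p (2 `A²` + `B` `O` + e₂), with e₂ taken over the odd reciprocals.
    -- There `A²` vanishes, `O` is -`B` and e₂ is `B`²/2 by Newton, so the bracket is -`B`²/2, with
    -- `B`² the square of `B`.
    PT≅ : P * T ≅ - x + - y ⟨mod P ^ 3 ⟩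
    PT≅ = ≅-trans (scale-≅ P T≅) (≡⇒≅ (identity P B h))
      where
      identity : ∀ P B h → P * (- B + P * - (h * (B * B))) ≡ - (P * B) + - (h * (P * B * (P * B)))
      identity = solve-∀
      E = ∑-of-products a N
      τ≅ : ∀ k → τ k ≅ a k + P * (+ 2 * (a k * a k) + B * a k + a k * ∑ k a) ⟨mod P ^ 2 ⟩
      τ≅ k = combination₂ (a k + + 2 * (P * (a k * a k))) ((B + ∑ k a) * (+ 2 * (a k * a k)))
        (step P (U k) B (∑ k a) (a k)) (U≅ k) q≅0
        where
        step : ∀ P U B S a → U * (a + + 2 * (P * (a * a))) + - (a + P * (+ 2 * (a * a) + B * a + a * S)) ≡
          (a + + 2 * (P * (a * a))) * (U + - (1ℤ + P * (B + S))) + (B + S) * (+ 2 * (a * a)) * (P * (P * 1ℤ) + - 0ℤ)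
        step = solve-∀
      collect : ∀ n → ∑ n (λ k → a k + P * (+ 2 * (a k * a k) + B * a k + a k * ∑ k a)) ≡
        ∑ n a + P * (+ 2 * ∑ n (λ k → a k * a k) + B * ∑ n a + ∑-of-products a n)
      collect zero    = base P B
        where
        base : ∀ P B → 0ℤ ≡ 0ℤ + P * (+ 2 * 0ℤ + B * 0ℤ + 0ℤ)
        base = solve-∀
      collect (suc n) = trans (cong (_+ (a n + P * (+ 2 * (a n * a n) + B * a n + a n * ∑ n a))) (collect n))
        (step P B (∑ n a) (∑ n λ k → a k * a k) (∑-of-products a n) (a n))
        where
        step : ∀ P B S R E t → S + P * (+ 2 * R + B * S + E) + (t + P * (+ 2 * (t * t) + B * t + t * S)) ≡
          S + t + P * (+ 2 * (R + t * t) + B * (S + t) + (E + t * S))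
        step = solve-∀
      O≅-B¹ : O ≅ - B ⟨mod P ⟩
      O≅-B¹ = 2→1 O≅-B
      E≅ : E ≅ h * (B * B) ⟨mod P ⟩
      E≅ = ≅-trans (∑-of-products≅ a N A²≅0) (*-congˡ-≅ h (square-neg O B O≅-B¹))
      inner : + 2 * A² + B * O + E ≅ - (h * (B * B)) ⟨mod P ⟩
      inner = ≅-trans (+-cong-≅ (+-cong-≅ (*-congˡ-≅ (+ 2) A²≅0) (*-congˡ-≅ B O≅-B¹)) E≅)
        (combination₁ (B * B) (halve B h) (4→1 h-inverse))
        where
        halve : ∀ B h → + 2 * 0ℤ + B * - B + h * (B * B) + - - (h * (B * B)) ≡ B * B * (+ 2 * h + - 1ℤ)
        halve = solve-∀
      T≅ : T ≅ - B + P * - (h * (B * B)) ⟨mod P ^ 2 ⟩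
      T≅ = begin
        T                                  ≈⟨ ∑≅.fold-cong (P ^ 2) N (λ k _ → τ≅ k) ⟩
        ∑ N (λ k → a k + P * (+ 2 * (a k * a k) + B * a k + a k * ∑ k a)) ≡⟨ collect N ⟩
        O + P * (+ 2 * A² + B * O + E)     ≈⟨ +-cong-≅ O≅-B (scale-≅ P (mod¹ inner)) ⟩
        - B + P * - (h * (B * B))          ∎
        where open ≅-Reasoning (P ^ 2)

    -- Evaluation of the sum modulo p⁴

    -- `e` is -1/128 and `g` is 1/64. The base -1024 of the theorem is 8 times -128, and the powers
    -- of 8 are used up by (4k)!.
    e g : ℤ
    e = - v 128
    g = - + 2 * e

    128e≅-1 : + 128 * e ≅ -1ℤ ⟨mod P ^ 4 ⟩
    128e≅-1 = combination₁ -1ℤ (identity (v 128)) (v-inverse 128 (∤-^ p-prime 2 7 p∤2))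
      where
      identity : ∀ w → + 128 * - w + - -1ℤ ≡ -1ℤ * (+ 128 * w + - 1ℤ)
      identity = solve-∀

    iodd ifac : ℕ → ℤ
    iodd k = ∏ k a
    ifac n = ∏ n c

    iodd-suc : ∀ k → k < N → iodd k ≅ + suc (k ℕ.+ k) * iodd (suc k) ⟨mod P ^ 4 ⟩
    iodd-suc k k<N = combination₁ (- iodd k) (identity (+ suc (k ℕ.+ k)) (iodd k) (a k)) (a-inverse k k<N)
      where
      identity : ∀ d z w → z + - (d * (z * w)) ≡ - z * (d * w + - 1ℤ)
      identity = solve-∀

    ifac-suc : ∀ n → n < N → ifac n ≅ + suc n * ifac (suc n) ⟨mod P ^ 4 ⟩
    ifac-suc n n<N = combination₁ (- ifac n) (identity (+ suc n) (ifac n) (c n))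
      (c-inverse n (ℕ.<-≤-trans n<N (ℕ.m≤m+n N N)))
      where
      identity : ∀ d z w → z + - (d * (z * w)) ≡ - z * (d * w + - 1ℤ)
      identity = solve-∀

    -- The WZ pair, only meaningful for n = k + j: the factor ifac j is 1/(n - k)!.
    S G : (k j n : ℕ) → ℤ
    S k j n = monomial (e ^ j * g ^ k) (+ 18 * + k + + 20 * + j + + 3)
      (odd n) (odd (n ℕ.+ n ℕ.+ k)) (iodd k) (ifac n) (ifac j)
    G k j n = monomial (e ^ j * g ^ k) 1ℤ
      (odd (suc n)) (odd (suc n ℕ.+ suc n ℕ.+ k)) (iodd (suc k)) (ifac n) (ifac j)

    odd-2n+2+k : ∀ n k → odd (suc n ℕ.+ suc n ℕ.+ k) ≡
      odd (n ℕ.+ n ℕ.+ k) * + suc (n ℕ.+ n ℕ.+ k ℕ.+ (n ℕ.+ n ℕ.+ k))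
        * + suc (suc (n ℕ.+ n ℕ.+ k) ℕ.+ suc (n ℕ.+ n ℕ.+ k))
    odd-2n+2+k n k = cong (λ m → odd (suc (m ℕ.+ k))) (ℕ.+-suc n n)

    -- The WZ equation at n = k, where the terms F(k, k+1) and G(k-1, k) are absent because they
    -- would contain 1/(-1)! = 0.
    wz-boundary : ∀ k → k < N → S k 0 k ≅ G k 0 k ⟨mod P ^ 4 ⟩
    wz-boundary k k<N = begin
      S k 0 k
        ≈⟨ monomial-cong {O₁ = odd k} {O₂ = odd (k ℕ.+ k ℕ.+ k)} ≅-refl ≅-refl (iodd-suc k k<N) ≅-refl ≅-refl ⟩
      monomial (1ℤ * g ^ k) (+ 18 * + k + + 20 * 0ℤ + + 3)
        (odd k) (odd (k ℕ.+ k ℕ.+ k)) (+ suc (k ℕ.+ k) * iodd (suc k)) (ifac k) 1ℤ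
        ≡⟨ wz-boundary-identity (+ k) (g ^ k) (odd k) (odd (k ℕ.+ k ℕ.+ k)) (iodd (suc k)) (ifac k) ⟩
      monomial (1ℤ * g ^ k) 1ℤ (odd (suc k))
        (odd (k ℕ.+ k ℕ.+ k) * + suc (k ℕ.+ k ℕ.+ k ℕ.+ (k ℕ.+ k ℕ.+ k))
          * + suc (suc (k ℕ.+ k ℕ.+ k) ℕ.+ suc (k ℕ.+ k ℕ.+ k))) (iodd (suc k)) (ifac k) 1ℤ
        ≡⟨ cong (λ o → monomial (1ℤ * g ^ k) 1ℤ (odd (suc k)) o (iodd (suc k)) (ifac k) 1ℤ) (odd-2n+2+k k k) ⟨
      G k 0 k ∎
      where
      open ≅-Reasoning (P ^ 4)

    -- With n = k + j + 1, F(n, k) = `S k (n - k) n` and likewise for `G`, this is the WZ equation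
    -- F(n, k) - F(n, k+1) = G(n, k) - G(n-1, k). The bound n ≤ N keeps every reciprocal involved a
    -- true inverse.
    wz-step : ∀ k j → suc (k ℕ.+ j) ≤ N →
      S k (suc j) (suc (k ℕ.+ j)) + G k j (k ℕ.+ j) ≅
      S (suc k) j (suc (k ℕ.+ j)) + G k (suc j) (suc (k ℕ.+ j)) ⟨mod P ^ 4 ⟩
    wz-step k j n≤N = begin
      S k (suc j) n + G k j (k ℕ.+ j)
        ≈⟨ +-cong-≅
             (monomial-cong {O₁ = O₁} {O₂ = O₂} ≅-refl ≅-refl (iodd-suc k k<N) ≅-refl ≅-refl)
             (monomial-cong {O₁ = O₁} {O₂ = O₂} {I = I} ≅-refl ≅-refl ≅-refl (ifac-suc (k ℕ.+ j) n≤N) (ifac-suc j j<N)) ⟩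
      monomial (e * E * Γ) (+ 18 * + k + + 20 * + suc j + + 3) O₁ O₂ (+ suc (k ℕ.+ k) * I) f f₂
        + monomial (E * Γ) 1ℤ O₁ O₂ I (+ n * f) (+ suc j * f₂)
        ≈⟨ wz-step-identity e (+ k) (+ j) E Γ O₁ O₂ I f f₂ 128e≅-1 ⟩
      monomial (E * (g * Γ)) (+ 18 * + suc k + + 20 * + j + + 3) O₁ (O₂ * + suc (m ℕ.+ m)) I f (+ suc j * f₂)
        + monomial (e * E * Γ) 1ℤ (odd (suc n)) (O₂ * + suc (m ℕ.+ m) * + suc (suc m ℕ.+ suc m)) I f f₂
        ≈⟨ +-cong-≅
             (monomial-cong {O₁ = O₁} {I = I} ≅-refl (≡⇒≅ (sym (cong odd (ℕ.+-suc (n ℕ.+ n) k)))) ≅-refl ≅-refl (≅-sym (ifac-suc j j<N)))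
             (monomial-cong {O₁ = odd (suc n)} {I = I} ≅-refl (≡⇒≅ (sym (odd-2n+2+k n k))) ≅-refl ≅-refl ≅-refl) ⟩
      S (suc k) j n + G k (suc j) n ∎
      where
      open ≅-Reasoning (P ^ 4)
      n = suc (k ℕ.+ j)
      m = n ℕ.+ n ℕ.+ k
      E = e ^ j
      Γ = g ^ k
      O₁ = odd n
      O₂ = odd m
      I = iodd (suc k)
      f = ifac n
      f₂ = ifac (suc j)
      k<N : k < N
      k<N = ℕ.≤-trans (s≤s (ℕ.m≤m+n k j)) n≤N
      j<N : j < N
      j<N = ℕ.≤-trans (s≤s (ℕ.m≤n+m j k)) n≤N

    partial-sum : (k j : ℕ) → ℤ
    partial-sum k j = ∑ (suc j) λ i → S k i (k ℕ.+ i)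

    S-shift : ∀ k j → S k (suc j) (k ℕ.+ suc j) ≡ S k (suc j) (suc (k ℕ.+ j))
    S-shift k j = cong (S k (suc j)) (ℕ.+-suc k j)

    -- The WZ equation summed over n from k to k + j + 1. The chain of `G` starts at `wz-boundary`,
    -- so only its last member is left.
    telescoping : ∀ k j → suc (k ℕ.+ j) ≤ N →
      partial-sum k (suc j) ≅ partial-sum (suc k) j + G k (suc j) (suc (k ℕ.+ j)) ⟨mod P ^ 4 ⟩
    telescoping k zero k<N = begin
      0ℤ + S k 0 (k ℕ.+ 0) + S k 1 (k ℕ.+ 1)
        ≡⟨ cong₂ (λ m z → 0ℤ + S k 0 m + z) (ℕ.+-identityʳ k) (S-shift k 0) ⟩
      0ℤ + S k 0 k + S k 1 (suc (k ℕ.+ 0))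
        ≈⟨ +-cong-≅ (+-cong-≅ (≅-refl {0ℤ}) (wz-boundary k (ℕ.≤-trans (s≤s (ℕ.m≤m+n k 0)) k<N))) ≅-refl ⟩
      0ℤ + G k 0 k + S k 1 (suc (k ℕ.+ 0))
        ≡⟨ swap (G k 0 k) (S k 1 (suc (k ℕ.+ 0))) ⟩
      S k 1 (suc (k ℕ.+ 0)) + G k 0 k
        ≡⟨ cong (λ m → S k 1 (suc (k ℕ.+ 0)) + G k 0 m) (ℕ.+-identityʳ k) ⟨
      S k 1 (suc (k ℕ.+ 0)) + G k 0 (k ℕ.+ 0)
        ≈⟨ wz-step k 0 k<N ⟩
      S (suc k) 0 (suc (k ℕ.+ 0)) + G k 1 (suc (k ℕ.+ 0))
        ≡⟨ cong (_+ G k 1 (suc (k ℕ.+ 0))) (ℤ.+-identityˡ (S (suc k) 0 (suc (k ℕ.+ 0)))) ⟨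
      partial-sum (suc k) 0 + G k 1 (suc (k ℕ.+ 0)) ∎
      where
      open ≅-Reasoning (P ^ 4)
      swap : ∀ x y → 0ℤ + x + y ≡ y + x
      swap = solve-∀
    telescoping k (suc j) n≤N = begin
      partial-sum k (suc j) + S k (2 ℕ.+ j) (k ℕ.+ (2 ℕ.+ j))
        ≡⟨ cong (λ z → partial-sum k (suc j) + z) (S-shift k (suc j)) ⟩
      partial-sum k (suc j) + S k (2 ℕ.+ j) (suc (k ℕ.+ suc j))
        ≈⟨ +-cong-≅ (telescoping k j (ℕ.<⇒≤ (subst (_< N) (ℕ.+-suc k j) n≤N))) ≅-refl ⟩
      partial-sum (suc k) j + G k (suc j) (suc (k ℕ.+ j)) + S k (2 ℕ.+ j) (suc (k ℕ.+ suc j))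
        ≡⟨ swap (partial-sum (suc k) j) _ (S k (2 ℕ.+ j) (suc (k ℕ.+ suc j))) ⟩
      partial-sum (suc k) j + (S k (2 ℕ.+ j) (suc (k ℕ.+ suc j)) + G k (suc j) (suc (k ℕ.+ j)))
        ≡⟨ cong (λ m → partial-sum (suc k) j + (S k (2 ℕ.+ j) (suc (k ℕ.+ suc j)) + G k (suc j) m)) (ℕ.+-suc k j) ⟨
      partial-sum (suc k) j + (S k (2 ℕ.+ j) (suc (k ℕ.+ suc j)) + G k (suc j) (k ℕ.+ suc j))
        ≈⟨ +-cong-≅ (≅-refl {partial-sum (suc k) j}) (wz-step k (suc j) n≤N) ⟩
      partial-sum (suc k) j + (S (suc k) (suc j) (suc (k ℕ.+ suc j)) + G k (2 ℕ.+ j) (suc (k ℕ.+ suc j)))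
        ≡⟨ ℤ.+-assoc (partial-sum (suc k) j) _ _ ⟨
      partial-sum (suc k) (suc j) + G k (2 ℕ.+ j) (suc (k ℕ.+ suc j)) ∎
      where
      open ≅-Reasoning (P ^ 4)
      swap : ∀ x y z → x + y + z ≡ x + (z + y)
      swap = solve-∀

    -- The factor of index N is p itself. It has no inverse modulo p⁴, so it must be split off
    -- exactly.
    odd-past-p : ∀ M → odd (N ℕ.+ suc M) ≡
      odd N * (P * ∏ M (λ i → + suc (N ℕ.+ suc i ℕ.+ (N ℕ.+ suc i))))
    odd-past-p M = begin
      odd (N ℕ.+ suc M)                         ≡⟨ ∏≡.fold-++ N (suc M) (λ i → + suc (i ℕ.+ i)) ⟩
      odd N * ∏ (suc M) (λ i → + suc (N ℕ.+ i ℕ.+ (N ℕ.+ i)))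
        ≡⟨ cong (odd N *_) (∏≡.fold-head M (λ i → + suc (N ℕ.+ i ℕ.+ (N ℕ.+ i)))) ⟩
      odd N * (+ suc (N ℕ.+ 0 ℕ.+ (N ℕ.+ 0)) * Π)
        ≡⟨ cong (λ n → odd N * (+ suc (n ℕ.+ n) * Π)) (ℕ.+-identityʳ N) ⟩
      odd N * (P * Π)                           ∎
      where
      open ≡-Reasoning
      Π = ∏ M (λ i → + suc (N ℕ.+ suc i ℕ.+ (N ℕ.+ suc i)))

    odd-inverse : odd N * iodd N ≅ 1ℤ ⟨mod P ^ 4 ⟩
    odd-inverse = begin
      odd N * iodd N                      ≈⟨ ∏≅.fold-∙ (P ^ 4) N _ a ⟨
      ∏ N (λ j → + suc (j ℕ.+ j) * a j)   ≈⟨ ∏≅.fold-cong (P ^ 4) N a-inverse ⟩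
      ∏ N (λ i → 1ℤ)                      ≡⟨ trans (∏-const N 1ℤ) (ℤ.^-zeroˡ N) ⟩
      1ℤ                                  ∎
      where open ≅-Reasoning (P ^ 4)

    κ ω : ℤ
    κ = (+ 8 * e) ^ N
    ω = P * (P * (κ * (X -1ℤ * X -1ℤ)))

    t²κ≅ : t * t * κ ≅ -1ℤ ^ N ⟨mod P ^ 4 ⟩
    t²κ≅ = ≅-trans (≡⇒≅ (begin
      t * t * κ                     ≡⟨ cong (_* κ) (^-*-swap (+ 4) (+ 4) N) ⟨
      (+ 16) ^ N * κ                ≡⟨ ^-*-swap (+ 16) (+ 8 * e) N ⟨
      (+ 16 * (+ 8 * e)) ^ N        ≡⟨ cong (_^ N) (ℤ.*-assoc (+ 16) (+ 8) e) ⟨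
      (+ 128 * e) ^ N               ∎)) (^-cong-≅ N 128e≅-1)
      where open ≡-Reasoning

    0<N : 0 < N
    0<N = positive N 3<p
      where
      positive : ∀ n → 3 < suc (n ℕ.+ n) → 0 < n
      positive zero    (s≤s ())
      positive (suc n) _ = s≤s z≤n

    a₀≅1 : a 0 ≅ 1ℤ ⟨mod P ^ 4 ⟩
    a₀≅1 = ≅-trans (≡⇒≅ (sym (ℤ.*-identityˡ (a 0)))) (a-inverse 0 0<N)

    -- One double factorial ends at p and the other at 4N + 3 = 2p + 1, which accounts for p² and
    -- for the factor 1 + 2p of `τ 0`.
    G-initial : G 0 N N ≅ ω * τ 0 ⟨mod P ^ 4 ⟩
    G-initial = begin
      G 0 N N
        ≈⟨ monomial-cong {O₁ = odd N * P} (*-cong-≅ odd-N ≅-refl) odd-2N+2 (≅-trans (≡⇒≅ (ℤ.*-identityˡ (a 0))) a₀≅1) ≅-refl ≅-refl ⟩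
      monomial (e ^ N * 1ℤ) 1ℤ (w′ * F * X -1ℤ * P) (w′ * F * X -1ℤ * (P * (w * F * X 1ℤ)) * (1ℤ + + 2 * P)) 1ℤ IF IF
        ≡⟨ wz-initial-identity (e ^ N) P w w′ F (X 1ℤ) (X -1ℤ) 1ℤ IF ⟩
      P * (P * (e ^ N * w′ * w′ * w * (X -1ℤ * X -1ℤ))) * X 1ℤ * (1ℤ + + 2 * P) * (1ℤ * 1ℤ) * (F * IF * (F * IF) * (F * IF))
        ≡⟨ cong (λ z → P * (P * (z * (X -1ℤ * X -1ℤ))) * X 1ℤ * (1ℤ + + 2 * P) * (1ℤ * 1ℤ) * (F * IF * (F * IF) * (F * IF))) κ-split ⟨
      ω * X 1ℤ * (1ℤ + + 2 * P) * (1ℤ * 1ℤ) * (F * IF * (F * IF) * (F * IF))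
        ≈⟨ *-congˡ-≅ (ω * X 1ℤ * (1ℤ + + 2 * P) * (1ℤ * 1ℤ)) (*-cong-≅ (*-cong-≅ F-inverse F-inverse) F-inverse) ⟩
      ω * X 1ℤ * (1ℤ + + 2 * P) * (1ℤ * 1ℤ) * (1ℤ * 1ℤ * 1ℤ)
        ≡⟨ rearrange ω (X 1ℤ) P ⟩
      ω * (X 1ℤ * 1ℤ * (1ℤ + + 2 * (P * (1ℤ * 1ℤ))))
        ≈⟨ *-congˡ-≅ ω (*-congˡ-≅ (X 1ℤ * 1ℤ) (+-cong-≅ a₀≅1 (*-congˡ-≅ (+ 2) (*-congˡ-≅ P (*-cong-≅ a₀≅1 a₀≅1))))) ⟨
      ω * τ 0 ∎
      where
      open ≅-Reasoning (P ^ 4)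
      w = (+ 2) ^ N
      w′ = (- + 2) ^ N
      rearrange : ∀ ω X P → ω * X * (1ℤ + + 2 * P) * (1ℤ * 1ℤ) * (1ℤ * 1ℤ * 1ℤ) ≡ ω * (X * 1ℤ * (1ℤ + + 2 * (P * (1ℤ * 1ℤ))))
      rearrange = solve-∀
      factor : ∀ e → + 8 * e ≡ e * - + 2 * - + 2 * + 2
      factor = solve-∀
      κ-split : κ ≡ e ^ N * w′ * w′ * w
      κ-split = trans (cong (_^ N) (factor e)) (trans (^-*-swap (e * - + 2 * - + 2) (+ 2) N)
        (cong (_* w) (trans (^-*-swap (e * - + 2) (- + 2) N) (cong (_* w′) (^-*-swap e (- + 2) N)))))
      4N+3 : ∀ N → 1ℤ + (N + (1ℤ + N) + (N + (1ℤ + N))) ≡ 1ℤ + + 2 * (1ℤ + (N + N))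
      4N+3 = solve-∀
      odd-2N+2 : odd (suc N ℕ.+ suc N ℕ.+ 0) ≅ w′ * F * X -1ℤ * (P * (w * F * X 1ℤ)) * (1ℤ + + 2 * P) ⟨mod P ^ 4 ⟩
      odd-2N+2 = ≅-trans (≡⇒≅ (cong odd (ℕ.+-identityʳ (suc N ℕ.+ suc N))))
        (*-cong-≅ (≅-trans (≡⇒≅ (odd-past-p N)) (*-cong-≅ odd-N (*-congˡ-≅ P odds-above-p))) (≡⇒≅ (4N+3 (+ N))))

    -- `τ` is built to match the ratio of neighbours along n = N. That ratio is -2(j+2) (2m+1) times
    -- the square of `a (suc k)`, where -2(j+2) = (2k+1) - p and 2m+1 = (2k+3) + 2p. The first
    -- contributes 1 - p `a k` over `a k`, the second the final factor of `τ (suc k)`.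
    G-closed : ∀ k j → suc (k ℕ.+ j) ≡ N → G k (suc j) N ≅ ω * τ k ⟨mod P ^ 4 ⟩
    G-closed zero    j eq = subst (λ m → G 0 m N ≅ ω * τ 0 ⟨mod P ^ 4 ⟩) (sym eq) G-initial
    G-closed (suc k) j eq = begin
      G (suc k) (suc j) N
        ≈⟨ monomial-cong {O₁ = odd (suc N)} {I = iodd (suc (suc k))} ≅-refl (≡⇒≅ (cong odd (ℕ.+-suc (suc N ℕ.+ suc N) k))) ≅-refl ≅-refl (ifac-suc (suc j) j+1<N) ⟩
      monomial (e * e ^ j * (g * g ^ k)) 1ℤ (odd (suc N)) (odd m * (1ℤ + (+ m + + m))) (iodd (suc k) * a (suc k)) (ifac N) ((+ 2 + + j) * ifac (2 ℕ.+ j))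
        ≡⟨ wz-ratio-identity e (+ j) (+ m) (e ^ j) (g ^ k) (odd (suc N)) (odd m) (iodd (suc k)) (a (suc k)) (ifac N) (ifac (2 ℕ.+ j)) ⟩
      - + 2 * (+ 2 + + j) * (1ℤ + (+ m + + m)) * (a (suc k) * a (suc k)) * G k (2 ℕ.+ j) N
        ≈⟨ *-congˡ-≅ (- + 2 * (+ 2 + + j) * (1ℤ + (+ m + + m)) * (a (suc k) * a (suc k))) (G-closed k (suc j) (trans (cong suc (ℕ.+-suc k j)) eq)) ⟩
      - + 2 * (+ 2 + + j) * (1ℤ + (+ m + + m)) * (a (suc k) * a (suc k)) * (ω * τ k)
        ≡⟨ cong₂ (λ y z → y * z * (a (suc k) * a (suc k)) * (ω * τ k)) (coefficient₁ eq) (coefficient₂ (+ N) (+ k)) ⟩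
      (1ℤ + (+ k + + k) + - P) * (1ℤ + (+ suc k + + suc k) + + 2 * P) * (a (suc k) * a (suc k)) * (ω * τ k)
        ≈⟨ combination₂ (ω * U′ * (1ℤ + + 2 * (P * a k)) * ((1ℤ + (+ suc k + + suc k) + + 2 * P) * (a (suc k) * a (suc k))))
             (ω * U′ * (1ℤ + + 2 * (P * a k)) * ((1ℤ + - (P * a k)) * a (suc k)))
             (identity ω (X 1ℤ) Π P (+ k) (a k) (a (suc k)))
             (a-inverse k (ℕ.<-trans (ℕ.n<1+n k) k+1<N)) (a-inverse (suc k) k+1<N) ⟩
      ω * τ (suc k) ∎
      where
      open ≅-Reasoning (P ^ 4)
      m = suc N ℕ.+ suc N ℕ.+ k
      Π = ∏ k λ j → (1ℤ + - (P * a j)) * (1ℤ + + 2 * (P * a j))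
      U′ = X 1ℤ * Π
      j+1<N : suc j < N
      j+1<N = subst (suc j <_) eq (s≤s (s≤s (ℕ.m≤n+m j k)))
      k+1<N : suc k < N
      k+1<N = subst (suc k <_) eq (s≤s (s≤s (ℕ.m≤m+n k j)))
      coefficient₁ : ∀ {n} → suc (suc k ℕ.+ j) ≡ n → - + 2 * (+ 2 + + j) ≡ 1ℤ + (+ k + + k) + - + suc (n ℕ.+ n)
      coefficient₁ refl = shape (+ k) (+ j)
        where
        shape : ∀ k j → - + 2 * (+ 2 + j) ≡ 1ℤ + (k + k) + - (1ℤ + (1ℤ + (1ℤ + k + j) + (1ℤ + (1ℤ + k + j))))
        shape = solve-∀
      coefficient₂ : ∀ N k → 1ℤ + (1ℤ + N + (1ℤ + N) + k + (1ℤ + N + (1ℤ + N) + k)) ≡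
        1ℤ + (1ℤ + k + (1ℤ + k)) + + 2 * (1ℤ + (N + N))
      coefficient₂ = solve-∀
      identity : ∀ ω X Π P k a a′ →
        (1ℤ + (k + k) + - P) * (1ℤ + (1ℤ + k + (1ℤ + k)) + + 2 * P) * (a′ * a′) * (ω * (X * Π * (a + + 2 * (P * (a * a)))))
        + - (ω * (X * (Π * ((1ℤ + - (P * a)) * (1ℤ + + 2 * (P * a)))) * (a′ + + 2 * (P * (a′ * a′))))) ≡
        ω * (X * Π) * (1ℤ + + 2 * (P * a)) * ((1ℤ + (1ℤ + k + (1ℤ + k)) + + 2 * P) * (a′ * a′)) * ((1ℤ + (k + k)) * a + - 1ℤ)
        + ω * (X * Π) * (1ℤ + + 2 * (P * a)) * ((1ℤ + - (P * a)) * a′) * ((1ℤ + (1ℤ + k + (1ℤ + k))) * a′ + - 1ℤ)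
      identity = solve-∀

    -- The 2N odd numbers strictly between p and 3p are p + 2i and 3p - 2i for 1 ≤ i ≤ N; they give
    -- `X` at 1 and at -3.
    S-final : S N 0 N ≅ P * (+ 3 * κ * (X 1ℤ * X (- + 3))) ⟨mod P ^ 4 ⟩
    S-final = begin
      S N 0 N
        ≡⟨ wz-final-identity (g ^ N) (+ N) (odd N) (odd (N ℕ.+ N ℕ.+ N)) (iodd N) IF ⟩
      + 3 * g ^ N * odd (suc (N ℕ.+ N ℕ.+ N)) * (odd N * iodd N) * iodd N * (IF * IF)
        ≡⟨ cong (λ n → + 3 * g ^ N * odd n * (odd N * iodd N) * iodd N * (IF * IF))
             (trans (cong suc (ℕ.+-assoc N N N)) (sym (ℕ.+-suc N (N ℕ.+ N)))) ⟩
      + 3 * g ^ N * odd (N ℕ.+ suc (N ℕ.+ N)) * (odd N * iodd N) * iodd N * (IF * IF)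
        ≡⟨ cong (λ o → + 3 * g ^ N * o * (odd N * iodd N) * iodd N * (IF * IF)) (odd-past-p (N ℕ.+ N)) ⟩
      + 3 * g ^ N * (odd N * (P * ∏ (N ℕ.+ N) odds)) * (odd N * iodd N) * iodd N * (IF * IF)
        ≈⟨ *-cong-≅ (*-cong-≅ (*-cong-≅ (*-congˡ-≅ (+ 3 * g ^ N) (*-congˡ-≅ (odd N) (*-congˡ-≅ P split))) odd-inverse) ≅-refl) ≅-refl ⟩
      + 3 * g ^ N * (odd N * (P * (w * F * X 1ℤ * (w′ * F * X (- + 3))))) * 1ℤ * iodd N * (IF * IF)
        ≡⟨ rearrange (g ^ N) (odd N) P w w′ F (X 1ℤ) (X (- + 3)) (iodd N) IF ⟩
      P * (+ 3 * (g ^ N * w * w′) * (X 1ℤ * X (- + 3))) * (odd N * iodd N * (F * IF * (F * IF)))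
        ≡⟨ cong (λ z → P * (+ 3 * z * (X 1ℤ * X (- + 3))) * (odd N * iodd N * (F * IF * (F * IF)))) κ-split ⟨
      P * (+ 3 * κ * (X 1ℤ * X (- + 3))) * (odd N * iodd N * (F * IF * (F * IF)))
        ≈⟨ *-congˡ-≅ (P * (+ 3 * κ * (X 1ℤ * X (- + 3)))) (*-cong-≅ odd-inverse (*-cong-≅ F-inverse F-inverse)) ⟩
      P * (+ 3 * κ * (X 1ℤ * X (- + 3))) * 1ℤ
        ≡⟨ ℤ.*-identityʳ _ ⟩
      P * (+ 3 * κ * (X 1ℤ * X (- + 3))) ∎
      where
      open ≅-Reasoning (P ^ 4)
      w = (+ 2) ^ N
      w′ = (- + 2) ^ N
      odds : ℕ → ℤ
      odds i = + suc (N ℕ.+ suc i ℕ.+ (N ℕ.+ suc i))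
      split : ∏ (N ℕ.+ N) odds ≅ w * F * X 1ℤ * (w′ * F * X (- + 3)) ⟨mod P ^ 4 ⟩
      split = ≅-trans (∏≅.fold-++ (P ^ 4) N N odds) (*-cong-≅ odds-above-p odds-below-3p)
      rearrange : ∀ Γ o P w w′ F X Y i f →
        + 3 * Γ * (o * (P * (w * F * X * (w′ * F * Y)))) * 1ℤ * i * (f * f) ≡
        P * (+ 3 * (Γ * w * w′) * (X * Y)) * (o * i * (F * f * (F * f)))
      rearrange = solve-∀
      factor : ∀ e → + 8 * e ≡ - + 2 * e * + 2 * - + 2
      factor = solve-∀
      κ-split : κ ≡ g ^ N * w * w′
      κ-split = trans (cong (_^ N) (factor e)) (trans (^-*-swap (g * + 2) (- + 2) N)
        (cong (_* w′) (^-*-swap g (+ 2) N)))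

    -- The invariant of repeated telescoping: `ω * ∑ k τ` holds the boundary terms already
    -- collected, and k + j stays equal to N.
    sum-evaluation : ∀ k j → k ℕ.+ j ≡ N → partial-sum k j + ω * ∑ k τ ≅ S N 0 N + ω * T ⟨mod P ^ 4 ⟩
    sum-evaluation k zero eq = ≡⇒≅ (trans
      (cong (_+ ω * ∑ k τ) (ℤ.+-identityˡ (S k 0 (k ℕ.+ 0))))
      (cong₂ (λ m n → S m 0 n + ω * ∑ m τ) (trans (sym (ℕ.+-identityʳ k)) eq) eq))
    sum-evaluation k (suc j) eq = begin
      partial-sum k (suc j) + ω * ∑ k τ
        ≈⟨ +-cong-≅ (telescoping k j (ℕ.≤-reflexive eq′)) ≅-refl ⟩
      partial-sum (suc k) j + G k (suc j) (suc (k ℕ.+ j)) + ω * ∑ k τ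
        ≡⟨ cong (λ n → partial-sum (suc k) j + G k (suc j) n + ω * ∑ k τ) eq′ ⟩
      partial-sum (suc k) j + G k (suc j) N + ω * ∑ k τ
        ≈⟨ +-cong-≅ (+-cong-≅ (≅-refl {partial-sum (suc k) j}) (G-closed k j eq′)) ≅-refl ⟩
      partial-sum (suc k) j + ω * τ k + ω * ∑ k τ
        ≡⟨ collect (partial-sum (suc k) j) ω (τ k) (∑ k τ) ⟩
      partial-sum (suc k) j + ω * ∑ (suc k) τ
        ≈⟨ sum-evaluation (suc k) j eq′ ⟩
      S N 0 N + ω * T ∎
      where
      open ≅-Reasoning (P ^ 4)
      eq′ : suc (k ℕ.+ j) ≡ N
      eq′ = trans (sym (ℕ.+-suc k j)) eq
      collect : ∀ x ω y z → x + ω * y + ω * z ≡ x + ω * (z + y)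
      collect = solve-∀

    integer-congruence : partial-sum 0 N ≅ P * (-1ℤ ^ N * (t + + 2 + - ((t + - 1ℤ) * (t + - 1ℤ)))) ⟨mod P ^ 4 ⟩
    integer-congruence = begin
      partial-sum 0 N                                ≡⟨ trans (sym (ℤ.+-identityʳ _)) (cong (λ z → partial-sum 0 N + z) (sym (ℤ.*-zeroʳ ω))) ⟩
      partial-sum 0 N + ω * ∑ 0 τ                    ≈⟨ sum-evaluation 0 N refl ⟩
      S N 0 N + ω * T                                ≈⟨ +-cong-≅ S-final ≅-refl ⟩
      P * (+ 3 * κ * (X 1ℤ * X (- + 3))) + ω * T     ≡⟨ factor P κ (X 1ℤ * X (- + 3)) (X -1ℤ * X -1ℤ) T ⟩
      P * (+ 3 * (κ * (X 1ℤ * X (- + 3))) + κ * (X -1ℤ * X -1ℤ) * (P * T))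
        -- `P ^ 4` unfolds to `P * P ^ 3`, so the terms behind the common factor are needed only
        -- modulo p³.
        ≈⟨ scale-≅ P (+-cong-≅ (*-congˡ-≅ (+ 3) (weight 1ℤ (- + 3) refl))
             (*-cong-≅ (weight -1ℤ -1ℤ refl) PT≅)) ⟩
      P * (+ 3 * σ + σ * (- x + - y))                ≡⟨ cong (P *_) (collect σ x y) ⟩
      P * (σ * (+ 3 + - x + - y))                    ≈⟨ scale-≅ P (*-congˡ-≅ σ target) ⟨
      P * (σ * (t + + 2 + - ((t + - 1ℤ) * (t + - 1ℤ)))) ∎
      where
      open ≅-Reasoning (P ^ 4)
      σ = -1ℤ ^ N
      factor : ∀ P κ X Y T → P * (+ 3 * κ * X) + P * (P * (κ * Y)) * T ≡ P * (+ 3 * (κ * X) + κ * Y * (P * T))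
      factor = solve-∀
      collect : ∀ σ x y → + 3 * σ + σ * (- x + - y) ≡ σ * (+ 3 + - x + - y)
      collect = solve-∀
      t²≅ : t * t ≅ ε (- + 2) ⟨mod P ^ 3 ⟩
      t²≅ = ≅-trans (*-cong-≅ t≅ε t≅ε) (ε-* -1ℤ -1ℤ)
      weight : ∀ r s → r + s ≡ - + 2 → κ * (X r * X s) ≅ σ ⟨mod P ^ 3 ⟩
      weight r s r+s≡-2 = ≅-trans
        (*-congˡ-≅ κ (≅-trans (*-cong-≅ (X≅ε r) (X≅ε s))
          (≅-trans (ε-* r s) (≅-trans (≡⇒≅ (cong ε r+s≡-2)) (≅-sym t²≅)))))
        (≅-trans (≡⇒≅ (ℤ.*-comm κ (t * t))) (weaken-≅ P t²κ≅))
      target : t + + 2 + - ((t + - 1ℤ) * (t + - 1ℤ)) ≅ + 3 + - x + - y ⟨mod P ^ 3 ⟩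
      target = ≅-trans
        (combination₁ (+ 3 + - t + - ε -1ℤ) (substitute t (ε -1ℤ)) t≅ε)
        (combination₃ -1ℤ (+ 2) -1ℤ (reduce x y) xx≅2y xy≅0 yy≅0)
        where
        substitute : ∀ t s → t + + 2 + - ((t + - 1ℤ) * (t + - 1ℤ)) + - (s + + 2 + - ((s + - 1ℤ) * (s + - 1ℤ))) ≡
          (+ 3 + - t + - s) * (t + - s)
        substitute = solve-∀
        reduce : ∀ x y → 1ℤ + -1ℤ * x + -1ℤ * -1ℤ * y + + 2
            + - ((1ℤ + -1ℤ * x + -1ℤ * -1ℤ * y + - 1ℤ) * (1ℤ + -1ℤ * x + -1ℤ * -1ℤ * y + - 1ℤ))
            + - (+ 3 + - x + - y) ≡
          -1ℤ * (x * x + - (y + y)) + + 2 * (x * y + - 0ℤ) + -1ℤ * (y * y + - 0ℤ)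
        reduce = solve-∀

    -- The first supplement to quadratic reciprocity

    fermat-unit : ∀ i → i < N ℕ.+ N → (+ suc i) ^ (N ℕ.+ N) ≅ 1ℤ ⟨mod P ⟩
    fermat-unit i i<p = cancel-≅ {a = (+ suc i) ^ (N ℕ.+ N)} {b = 1ℤ} {u = + suc i} {v = c i} (4→1 (c-inverse i i<p))
      (≅-trans (fermat p-prime (suc i)) (≡⇒≅ (sym (ℤ.*-identityʳ (+ suc i)))))

    -- The (p-1)-st difference of y^(p-1) at 0 is (p-1)!. It depends only on the values at 0, ...,
    -- p-1, where Fermat replaces the power by `nonzero`.
    wilson : ∏ (N ℕ.+ N) (λ i → + suc i) ≅ -1ℤ ⟨mod P ⟩
    wilson = begin
      ∏ (N ℕ.+ N) (λ i → + suc i)                       ≡⟨ Δ-power (N ℕ.+ N) 0 ⟨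
      Δ (N ℕ.+ N) (λ y → (+ y) ^ (N ℕ.+ N)) 0           ≈⟨ Δ-cong (N ℕ.+ N) 0 power≅nonzero ⟩
      Δ (N ℕ.+ N) nonzero 0                             ≡⟨ at-even (N ℕ.+ N) (-1^even N) 2N≢0 ⟩
      -1ℤ                                               ∎
      where
      open ≅-Reasoning P
      2N≢0 : 0 < N ℕ.+ N
      2N≢0 = ℕ.<-trans (s≤s z≤n) (ℕ.≤-pred 3<p)
      zero-power : ∀ n → 0 < n → 0ℤ ^ n ≡ 0ℤ
      zero-power (suc n) _ = refl
      power≅nonzero : ∀ i → i ≤ N ℕ.+ N ℕ.+ 0 → (+ i) ^ (N ℕ.+ N) ≅ nonzero i ⟨mod P ⟩
      power≅nonzero zero    _  = ≡⇒≅ (zero-power (N ℕ.+ N) 2N≢0)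
      power≅nonzero (suc i) i≤ = fermat-unit i (subst (suc i ≤_) (ℕ.+-identityʳ (N ℕ.+ N)) i≤)
      at-even : ∀ n → -1ℤ ^ n ≡ 1ℤ → 0 < n → Δ n nonzero 0 ≡ -1ℤ
      at-even (suc m) -1ⁿ≡1 _ = trans (Δ-nonzero m) (trans (identity (-1ℤ ^ m)) (cong -_ -1ⁿ≡1))
        where
        identity : ∀ z → z ≡ - (-1ℤ * z)
        identity = solve-∀

    -- The upper half of (p-1)! is reflected onto the lower half. For even N this makes N! a square
    -- root of -1.
    N!² : -1ℤ ^ N * (+ (N !) * + (N !)) ≅ -1ℤ ⟨mod P ⟩
    N!² = begin
      σ * (+ (N !) * + (N !))                      ≡⟨ cong (λ z → σ * (z * z)) (∏-suc≡! N) ⟨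
      σ * (F * F)                                  ≡⟨ rearrange σ F ⟩
      F * (σ * F)                                  ≡⟨ cong (λ z → F * (z * F)) (∏-const N -1ℤ) ⟨
      F * (∏ N (λ _ → -1ℤ) * F)                    ≡⟨ cong (F *_) (∏≡.fold-∙ N (λ _ → -1ℤ) (λ i → + suc i)) ⟨
      F * ∏ N (λ i → -1ℤ * + suc i)                ≈⟨ *-congˡ-≅ F (∏≅.fold-reverse P N reflected) ⟩
      F * ∏ N (λ j → + suc (N ℕ.+ j))              ≡⟨ ∏≡.fold-++ N N (λ i → + suc i) ⟨
      ∏ (N ℕ.+ N) (λ i → + suc i)                  ≈⟨ wilson ⟩
      -1ℤ                                          ∎
      where
      open ≅-Reasoning P
      σ = -1ℤ ^ N
      rearrange : ∀ σ F → σ * (F * F) ≡ F * (σ * F)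
      rearrange = solve-∀
      reflected : ∀ i j → suc (i ℕ.+ j) ≡ N → -1ℤ * + suc i ≅ + suc (N ℕ.+ j) ⟨mod P ⟩
      reflected i j eq = ≅-trans (modulo -1ℤ (identity (+ suc i) P)) (≡⇒≅ (sym (upper-reflection i j eq)))
        where
        identity : ∀ i P → -1ℤ * i ≡ P + - i + -1ℤ * P
        identity = solve-∀

    SquareRoot : Fin p → Set
    SquareRoot x = P ∣ (+ toℕ x) ^ 2 - -1ℤ

    even⇒root : -1ℤ ^ N ≡ 1ℤ → ∃ SquareRoot
    even⇒root σ≡1 = fromℕ< (m%n<n (N !) p) , ≅⇒∣ (begin
      (+ toℕ (fromℕ< (m%n<n (N !) p))) ^ 2   ≡⟨ cong (λ m → (+ m) ^ 2) (Fin.toℕ-fromℕ< (m%n<n (N !) p)) ⟩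
      (+ (N ! % p)) ^ 2                      ≈⟨ ^-cong-≅ 2 reduced ⟨
      (+ (N !)) ^ 2                          ≡⟨ square (+ (N !)) ⟩
      1ℤ * (+ (N !) * + (N !))               ≡⟨ cong (_* (+ (N !) * + (N !))) σ≡1 ⟨
      -1ℤ ^ N * (+ (N !) * + (N !))          ≈⟨ N!² ⟩
      -1ℤ                                    ∎)
      where
      open ≅-Reasoning P
      square : ∀ x → x * (x * 1ℤ) ≡ 1ℤ * (x * x)
      square = solve-∀
      reduced : + (N !) ≅ + (N ! % p) ⟨mod P ⟩
      reduced = modulo (+ (N ! ℕ./ p)) (trans (cong +_ (m≡m%n+[m/n]*n (N !) p))
        (cong (λ z → + (N ! % p) + z) (ℤ.pos-* (N ! ℕ./ p) p)))

    -- A root r would satisfy r^(p-1) ≡ (-1)^N = -1, so Fermat's r^p ≡ r reads -r ≡ r; multiplying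
    -- by r yields 2 ≡ 0.
    odd⇒¬root : -1ℤ ^ N ≡ -1ℤ → ¬ ∃ SquareRoot
    odd⇒¬root σ≡-1 (i , P∣x²+1) = p∤2 (∣⇒∣ᵤ (≅⇒∣ 2≅0))
      where
      open ≅-Reasoning P
      r = + toℕ i
      r²≅-1 : r ^ 2 ≅ -1ℤ ⟨mod P ⟩
      r²≅-1 = ∣⇒≅ P∣x²+1
      r^2N≅-1 : r ^ (N ℕ.+ N) ≅ -1ℤ ⟨mod P ⟩
      r^2N≅-1 = begin
        r ^ (N ℕ.+ N)    ≡⟨ ℤ.^-distribˡ-+-* r N N ⟩
        r ^ N * r ^ N    ≡⟨ ^-*-swap r r N ⟨
        (r * r) ^ N      ≡⟨ cong (λ z → (r * z) ^ N) (ℤ.*-identityʳ r) ⟨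
        (r ^ 2) ^ N      ≈⟨ ^-cong-≅ N r²≅-1 ⟩
        -1ℤ ^ N          ≡⟨ σ≡-1 ⟩
        -1ℤ              ∎
      r*-1≅r : r * -1ℤ ≅ r ⟨mod P ⟩
      r*-1≅r = ≅-trans (*-congˡ-≅ r (≅-sym r^2N≅-1)) (fermat p-prime (toℕ i))
      2≅0 : + 2 ≅ 0ℤ ⟨mod P ⟩
      2≅0 = combination₂ (+ 2) r (identity r) r²≅-1 r*-1≅r
        where
        identity : ∀ x → + 2 + - 0ℤ ≡ + 2 * (x * (x * 1ℤ) + - -1ℤ) + x * (x * -1ℤ + - x)
        identity = solve-∀

    P∤-1 : ¬ P ∣ -1ℤ
    P∤-1 P∣-1 = p∤1 p-prime (∣⇒∣ᵤ P∣-1)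

    root? = Fin.any? {n = p} λ x → P ∣? (+ toℕ x) ^ 2 - -1ℤ

    legendre-1 : legendre -1ℤ p ≡ -1ℤ ^ N
    legendre-1 = trans
      (cong (λ b → if b then 0ℤ else (if does root? then 1ℤ else -1ℤ)) (dec-false (P ∣? -1ℤ) P∤-1))
      by-parity
      where
      by-parity : (if does root? then 1ℤ else -1ℤ) ≡ -1ℤ ^ N
      by-parity with parity N
      ... | inj₁ (m , eq) = trans (cong (λ b → if b then 1ℤ else -1ℤ) (dec-true root? (even⇒root σ≡1))) (sym σ≡1)
        where
        σ≡1 : -1ℤ ^ N ≡ 1ℤ
        σ≡1 = trans (cong (-1ℤ ^_) eq) (-1^even m)
      ... | inj₂ (m , eq) = trans (cong (λ b → if b then 1ℤ else -1ℤ) (dec-false root? (odd⇒¬root σ≡-1))) (sym σ≡-1)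
        where
        σ≡-1 : -1ℤ ^ N ≡ -1ℤ
        σ≡-1 = trans (cong (-1ℤ ^_) eq) (cong (-1ℤ *_) (-1^even m))

open Integers

open import Defs
open import Data.Fin.Base using (toℕ)
open import Data.Integer.Base as ℤ using (ℤ; +_; -1ℤ; 1ℤ; 0ℤ; ∣_∣)
import Data.Integer.Properties as ℤ
open import Data.Integer.Tactic.RingSolver using (solve-∀)
open import Data.Nat.Coprimality as Coprimality using (coprime-divisor; 1-coprimeTo)
open import Data.Nat.DivMod using (m*n/n≡m)
open import Data.Rational.Base using (ℚ; mkℚ; _*_; _+_; _-_; _/_; 1/_; toℚᵘ; fromℚᵘ; 0ℚ; 1ℚ)
open import Data.Rational.Literals using (fromℤ)
open import Data.Rational.Properties using (+-0-commutativeMonoid)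
import Data.Rational.Properties as ℚ
open import Data.Rational.Solver using (module +-*-Solver)
open import Data.Rational.Unnormalised.Base as ℚᵘ using (mkℚᵘ; *≡*)
import Data.Rational.Unnormalised.Properties as ℚᵘ
open import Algebra.Properties.CommutativeMonoid.Sum +-0-commutativeMonoid using (sum; sum⁺-syntax)

-- From congruences of integers to congruences of rationals

fromℤ-+ : ∀ i j → fromℤ (i ℤ.+ j) ≡ fromℤ i + fromℤ j
fromℤ-+ i j = ℚ.toℚᵘ-injective (ℚᵘ.≃-trans (*≡* (identity i j)) (ℚᵘ.≃-sym (ℚ.toℚᵘ-homo-+ (fromℤ i) (fromℤ j))))
  where
  identity : ∀ i j → (i ℤ.+ j) ℤ.* 1ℤ ≡ (i ℤ.* 1ℤ ℤ.+ j ℤ.* 1ℤ) ℤ.* 1ℤ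
  identity = solve-∀

fromℤ-* : ∀ i j → fromℤ (i ℤ.* j) ≡ fromℤ i * fromℤ j
fromℤ-* i j = ℚ.toℚᵘ-injective (ℚᵘ.≃-trans (*≡* refl) (ℚᵘ.≃-sym (ℚ.toℚᵘ-homo-* (fromℤ i) (fromℤ j))))

/-*-cancel : ∀ i d .{{_ : ℕ.NonZero d}} → (i / d) * fromℤ (+ d) ≡ fromℤ i
/-*-cancel i (suc d) = ℚ.toℚᵘ-injective (begin
  toℚᵘ ((i / suc d) * fromℤ (+ suc d))             ≈⟨ ℚ.toℚᵘ-homo-* (i / suc d) (fromℤ (+ suc d)) ⟩
  toℚᵘ (fromℚᵘ (mkℚᵘ i d)) ℚᵘ.* mkℚᵘ (+ suc d) 0   ≈⟨ ℚᵘ.*-congʳ (ℚ.toℚᵘ-fromℚᵘ (mkℚᵘ i d)) ⟩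
  mkℚᵘ i d ℚᵘ.* mkℚᵘ (+ suc d) 0                   ≈⟨ *≡* (trans (ℤ.*-identityʳ _) (cong (λ n → i ℤ.* + n) (sym (ℕ.*-identityʳ (suc d))))) ⟩
  mkℚᵘ i 0                                         ∎)
  where open import Relation.Binary.Reasoning.Setoid ℚᵘ.≃-setoid

module _ {p : ℕ} (p-prime : Prime p) where

  -- The reduced denominator of a divides its numerator times d and is prime to the numerator, so it
  -- divides d.
  integral : ∀ a d z → ¬ p ℕ.∣ ∣ d ∣ → a * fromℤ d ≡ fromℤ z → Integral p a
  integral a@(mkℚ n den-1 n⊥den) d z p∤d ad≡z = Coprimality.sym (∤-coprime p-prime p∤den)
    where
    den = suc den-1
    cleared : n ℤ.* d ℤ.* 1ℤ ≡ z ℤ.* + (den ℕ.* 1)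
    cleared with *≡* eq ← ℚᵘ.≃-trans (ℚᵘ.≃-sym (ℚ.toℚᵘ-homo-* a (fromℤ d))) (ℚ.toℚᵘ-cong ad≡z) = eq
    den∣nd : den ℕ.∣ ∣ n ∣ ℕ.* ∣ d ∣
    den∣nd = ℕ.divides ∣ z ∣ (begin
      ∣ n ∣ ℕ.* ∣ d ∣           ≡⟨ ℤ.abs-* n d ⟨
      ∣ n ℤ.* d ∣               ≡⟨ cong ∣_∣ (trans (sym (ℤ.*-identityʳ (n ℤ.* d))) cleared) ⟩
      ∣ z ℤ.* + (den ℕ.* 1) ∣   ≡⟨ ℤ.abs-* z (+ (den ℕ.* 1)) ⟩
      ∣ z ∣ ℕ.* (den ℕ.* 1)     ≡⟨ cong (∣ z ∣ ℕ.*_) (ℕ.*-identityʳ den) ⟩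
      ∣ z ∣ ℕ.* den             ∎)
      where open ≡-Reasoning
    p∤den : ¬ p ℕ.∣ den
    p∤den p∣den = p∤d (ℕ.∣-trans p∣den
      (coprime-divisor (Coprimality.sym (Coprimality.recompute n⊥den)) den∣nd))

  infix 4 _↦_⟨mod_⟩

  -- a = z/d with p ∤ d, and x is the residue of z/d modulo q.
  record _↦_⟨mod_⟩ (a : ℚ) (x q : ℤ) : Set where
    constructor residue
    field
      denominator numerator : ℤ
      unit     : ¬ p ℕ.∣ ∣ denominator ∣
      fraction : a * fromℤ denominator ≡ fromℤ numerator
      reduced  : numerator ≅ denominator ℤ.* x ⟨mod q ⟩

  ↦-0 : ∀ {q} → 0ℚ ↦ 0ℤ ⟨mod q ⟩
  ↦-0 = residue 1ℤ 0ℤ (p∤1 p-prime) refl ≅-refl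

  ↦-+ : ∀ {a b x y q} → a ↦ x ⟨mod q ⟩ → b ↦ y ⟨mod q ⟩ → a + b ↦ x ℤ.+ y ⟨mod q ⟩
  ↦-+ {a} {b} {x} {y} (residue d₁ z₁ p∤d₁ f₁ r₁) (residue d₂ z₂ p∤d₂ f₂ r₂) =
    residue (d₁ ℤ.* d₂) (z₁ ℤ.* d₂ ℤ.+ z₂ ℤ.* d₁)
      (subst (λ d → ¬ p ℕ.∣ d) (sym (ℤ.abs-* d₁ d₂)) (∤-* p-prime ∣ d₁ ∣ ∣ d₂ ∣ p∤d₁ p∤d₂))
      (begin
        (a + b) * fromℤ (d₁ ℤ.* d₂)                       ≡⟨ cong ((a + b) *_) (fromℤ-* d₁ d₂) ⟩
        (a + b) * (fromℤ d₁ * fromℤ d₂)                   ≡⟨ expand a b (fromℤ d₁) (fromℤ d₂) ⟩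
        a * fromℤ d₁ * fromℤ d₂ + b * fromℤ d₂ * fromℤ d₁ ≡⟨ cong₂ (λ u v → u * fromℤ d₂ + v * fromℤ d₁) f₁ f₂ ⟩
        fromℤ z₁ * fromℤ d₂ + fromℤ z₂ * fromℤ d₁         ≡⟨ cong₂ _+_ (fromℤ-* z₁ d₂) (fromℤ-* z₂ d₁) ⟨
        fromℤ (z₁ ℤ.* d₂) + fromℤ (z₂ ℤ.* d₁)             ≡⟨ fromℤ-+ (z₁ ℤ.* d₂) (z₂ ℤ.* d₁) ⟨
        fromℤ (z₁ ℤ.* d₂ ℤ.+ z₂ ℤ.* d₁)                   ∎)
      (combination₂ d₂ d₁ (identity d₁ d₂ z₁ z₂ x y) r₁ r₂)
    where
    open ≡-Reasoning
    identity : ∀ d₁ d₂ z₁ z₂ x y →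
      z₁ ℤ.* d₂ ℤ.+ z₂ ℤ.* d₁ ℤ.+ ℤ.- (d₁ ℤ.* d₂ ℤ.* (x ℤ.+ y)) ≡
      d₂ ℤ.* (z₁ ℤ.+ ℤ.- (d₁ ℤ.* x)) ℤ.+ d₁ ℤ.* (z₂ ℤ.+ ℤ.- (d₂ ℤ.* y))
    identity = solve-∀
    expand : ∀ a b u v → (a + b) * (u * v) ≡ a * u * v + b * v * u
    expand = solve 4 (λ a b u v → (a :+ b) :* (u :* v) := a :* u :* v :+ b :* v :* u) refl
      where open +-*-Solver

  ↦-sum : ∀ n {a : ℕ → ℚ} {x q} → (∀ k → k < n → a k ↦ x k ⟨mod q ⟩) →
    sum {n} (a ∘ toℕ) ↦ ∑ n x ⟨mod q ⟩
  ↦-sum zero            a↦x = ↦-0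
  ↦-sum (suc n) {x = x} {q} a↦x =
    subst (_ ↦_⟨mod q ⟩) (sym (∑≡.fold-head n x))
      (↦-+ (a↦x 0 (s≤s z≤n)) (↦-sum n λ k k<n → a↦x (suc k) (s≤s k<n)))

  ↦⇒≡[mod] : ∀ {a x y} m → a ↦ x ⟨mod + (p ℕ.^ m) ⟩ → x ≅ y ⟨mod + (p ℕ.^ m) ⟩ →
    a ≡ fromℤ y [mod p ↑ m ]
  ↦⇒≡[mod] {a} {x} {y} m (residue d z p∤d ad≡z z≅dx) x≅y with ≅-trans z≅dx (*-congˡ-≅ d x≅y)
  -- The match writes the numerator as d y + n p^m, so the required quotient is n/d.
  ... | modulo n refl = record
    { integralˡ = integral a d z p∤d ad≡z
    ; integralʳ = 1-coprimeTo p
    ; quotient  = c , integral c d n p∤d cd≡n , difference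
    }
    where
    open ≡-Reasoning
    open +-*-Solver using (solve; _:+_; _:*_; _:-_; :-_; _:=_)
    q = + (p ℕ.^ m)
    instance
      d≢0 : ℕ.NonZero ∣ d ∣
      d≢0 = ℕ.≢-nonZero λ d≡0 → p∤d (subst (p ℕ.∣_) (sym d≡0) (p ℕ.∣0))
    D = fromℤ d
    c = fromℤ n * 1/ D
    cd≡n : c * D ≡ fromℤ n
    cd≡n = trans (ℚ.*-assoc (fromℤ n) (1/ D) D)
      (trans (cong (fromℤ n *_) (ℚ.*-inverseˡ D)) (ℚ.*-identityʳ (fromℤ n)))
    cancel-D : ∀ u v → u * D ≡ v * D → u ≡ v
    cancel-D u v uD≡vD = begin
      u                ≡⟨ restore u ⟨
      u * D * 1/ D     ≡⟨ cong (_* 1/ D) uD≡vD ⟩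
      v * D * 1/ D     ≡⟨ restore v ⟩
      v                ∎
      where
      restore : ∀ u → u * D * 1/ D ≡ u
      restore u = trans (ℚ.*-assoc u D (1/ D)) (trans (cong (u *_) (ℚ.*-inverseʳ D)) (ℚ.*-identityʳ u))
    difference : a - fromℤ y ≡ fromℤ q * c
    difference = cancel-D (a - fromℤ y) (fromℤ q * c) (begin
      (a - fromℤ y) * D                                      ≡⟨ solve 3 (λ a y D → (a :- y) :* D := a :* D :- D :* y) refl a (fromℤ y) D ⟩
      a * D - D * fromℤ y                                    ≡⟨ cong (_- D * fromℤ y) ad≡z ⟩
      fromℤ (d ℤ.* y ℤ.+ n ℤ.* q) - D * fromℤ y              ≡⟨ cong (_- D * fromℤ y) (trans (fromℤ-+ (d ℤ.* y) (n ℤ.* q)) (cong₂ _+_ (fromℤ-* d y) (fromℤ-* n q))) ⟩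
      D * fromℤ y + fromℤ n * fromℤ q - D * fromℤ y          ≡⟨ solve 3 (λ u n q → u :+ n :* q :- u := q :* n) refl (D * fromℤ y) (fromℤ n) (fromℤ q) ⟩
      fromℤ q * fromℤ n                                      ≡⟨ cong (fromℤ q *_) cd≡n ⟨
      fromℤ q * (c * D)                                      ≡⟨ ℚ.*-assoc (fromℤ q) c D ⟨
      fromℤ q * c * D                                        ∎)

-- The summands and their residues

abs-^ : ∀ i n → ∣ i ℤ.^ n ∣ ≡ ∣ i ∣ ℕ.^ n
abs-^ i zero    = refl
abs-^ i (suc n) = trans (ℤ.abs-* i (i ℤ.^ n)) (cong (∣ i ∣ ℕ.*_) (abs-^ i n))

pos-^ : ∀ m n → + (m ℕ.^ n) ≡ (+ m) ℤ.^ n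
pos-^ m zero    = refl
pos-^ m (suc n) = trans (ℤ.pos-* m (m ℕ.^ n)) (cong (+ m ℤ.*_) (pos-^ m n))

-1024ℤ : ℤ
-1024ℤ = ℤ.- ((+ 2) ℤ.^ 10)

summand : ℕ → ℚ
summand k = fromℤ (+ (20 ℕ.* k ℕ.+ 3)) ÷[ -1024ℤ ↑ k ] * multinomial₄ k

summand-fraction : ∀ k → summand k * fromℤ (-1024ℤ ℤ.^ k ℤ.* + ((k !) ℕ.^ 4)) ≡
  fromℤ (+ (20 ℕ.* k ℕ.+ 3) ℤ.* + ((4 ℕ.* k) !))
summand-fraction k = begin
  L * 1/ I * multinomial₄ k * fromℤ (-1024ℤ ℤ.^ k ℤ.* + ((k !) ℕ.^ 4))
    ≡⟨ cong (L * 1/ I * multinomial₄ k *_) (fromℤ-* (-1024ℤ ℤ.^ k) (+ ((k !) ℕ.^ 4))) ⟩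
  L * 1/ I * multinomial₄ k * (I * fromℤ (+ ((k !) ℕ.^ 4)))
    ≡⟨ solve 5 (λ l j m i f → l :* j :* m :* (i :* f) := l :* (j :* i) :* (m :* f)) refl L (1/ I) (multinomial₄ k) I _ ⟩
  L * (1/ I * I) * (multinomial₄ k * fromℤ (+ ((k !) ℕ.^ 4)))
    ≡⟨ cong₂ (λ u v → L * u * v) (ℚ.*-inverseˡ I) (/-*-cancel (+ ((4 ℕ.* k) !)) ((k !) ℕ.^ 4)) ⟩
  L * 1ℚ * fromℤ (+ ((4 ℕ.* k) !))
    ≡⟨ cong (_* fromℤ (+ ((4 ℕ.* k) !))) (ℚ.*-identityʳ L) ⟩
  L * fromℤ (+ ((4 ℕ.* k) !))
    ≡⟨ fromℤ-* (+ (20 ℕ.* k ℕ.+ 3)) (+ ((4 ℕ.* k) !)) ⟨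
  fromℤ (+ (20 ℕ.* k ℕ.+ 3) ℤ.* + ((4 ℕ.* k) !)) ∎
  where
  open ≡-Reasoning
  open +-*-Solver using (solve; _:*_; _:=_)
  instance
    _ = i^n≢0 -1024ℤ k
    _ = ℕ.m^n≢0 (k !) 4 {{ℕ._!≢0 k}}
  L = fromℤ (+ (20 ℕ.* k ℕ.+ 3))
  I = fromℤ (-1024ℤ ℤ.^ k)

-- Odd and even factors are separated twice. The two double factorials are those of `S 0 k k`, and
-- the powers of 2 combine to 8^k.
[4k]! : ∀ k → + ((4 ℕ.* k) !) ≡
  odd (k ℕ.+ k) ℤ.* ((+ 2) ℤ.^ (k ℕ.+ k) ℤ.* (odd k ℤ.* ((+ 2) ℤ.^ k ℤ.* + (k !))))
[4k]! k = begin
  + ((4 ℕ.* k) !)                                    ≡⟨ cong (λ n → + (n !)) (4k≡2k+2k k) ⟩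
  + ((k ℕ.+ k ℕ.+ (k ℕ.+ k)) !)                      ≡⟨ [2n]! (k ℕ.+ k) ⟩
  odd (k ℕ.+ k) ℤ.* ((+ 2) ℤ.^ (k ℕ.+ k) ℤ.* + ((k ℕ.+ k) !))
    ≡⟨ cong (λ z → odd (k ℕ.+ k) ℤ.* ((+ 2) ℤ.^ (k ℕ.+ k) ℤ.* z)) ([2n]! k) ⟩
  odd (k ℕ.+ k) ℤ.* ((+ 2) ℤ.^ (k ℕ.+ k) ℤ.* (odd k ℤ.* ((+ 2) ℤ.^ k ℤ.* + (k !)))) ∎
  where
  open ≡-Reasoning
  4k≡2k+2k : ∀ k → 4 ℕ.* k ≡ k ℕ.+ k ℕ.+ (k ℕ.+ k)
  4k≡2k+2k k = trans (cong (λ n → k ℕ.+ (k ℕ.+ (k ℕ.+ n))) (ℕ.+-identityʳ k)) (sym (ℕ.+-assoc k k (k ℕ.+ k)))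
  [2n]! : ∀ n → + ((n ℕ.+ n) !) ≡ odd n ℤ.* ((+ 2) ℤ.^ n ℤ.* + (n !))
  [2n]! n = begin
    + ((n ℕ.+ n) !)                                          ≡⟨ ∏-suc≡! (n ℕ.+ n) ⟨
    ∏ (n ℕ.+ n) (λ i → + suc i)                              ≡⟨ ∏-suc-double n ⟩
    odd n ℤ.* ((+ 2) ℤ.^ n ℤ.* ∏ n (λ i → + suc i))          ≡⟨ cong (λ z → odd n ℤ.* ((+ 2) ℤ.^ n ℤ.* z)) (∏-suc≡! n) ⟩
    odd n ℤ.* ((+ 2) ℤ.^ n ℤ.* + (n !))                      ∎

module _ (N : ℕ) (p-prime : Prime (suc (N ℕ.+ N))) (3<p : 3 < suc (N ℕ.+ N)) where
  open ModPrime N p-prime 3<p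

  -- Three of the four factors k! meet their reciprocals in `S 0 k k`. The fourth, together with
  -- (-1024 e)^k ≡ 8^k, supplies what `[4k]!` contains besides the double factorials.
  summand-reduced : ∀ k → k ≤ N →
    + (20 ℕ.* k ℕ.+ 3) ℤ.* + ((4 ℕ.* k) !) ≅ -1024ℤ ℤ.^ k ℤ.* + ((k !) ℕ.^ 4) ℤ.* S 0 k k ⟨mod P ℤ.^ 4 ⟩
  summand-reduced k k≤N = ≅-sym (begin
    -1024ℤ ℤ.^ k ℤ.* + ((k !) ℕ.^ 4) ℤ.* S 0 k k
      ≡⟨ cong₂ (λ u v → -1024ℤ ℤ.^ k ℤ.* u ℤ.* v) (pos-^ (k !) 4)
           (wz-summand-identity (e ℤ.^ k) (+ k) (odd k) (odd (k ℕ.+ k ℕ.+ 0)) (ifac k)) ⟩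
    -1024ℤ ℤ.^ k ℤ.* (+ (k !)) ℤ.^ 4 ℤ.* (e ℤ.^ k ℤ.* L ℤ.* odd k ℤ.* odd (k ℕ.+ k ℕ.+ 0) ℤ.* (ifac k ℤ.* ifac k ℤ.* ifac k))
      ≡⟨ cong (λ n → -1024ℤ ℤ.^ k ℤ.* (+ (k !)) ℤ.^ 4 ℤ.* (e ℤ.^ k ℤ.* L ℤ.* odd k ℤ.* odd n ℤ.* (ifac k ℤ.* ifac k ℤ.* ifac k))) (ℕ.+-identityʳ (k ℕ.+ k)) ⟩
    -1024ℤ ℤ.^ k ℤ.* (+ (k !)) ℤ.^ 4 ℤ.* (e ℤ.^ k ℤ.* L ℤ.* odd k ℤ.* odd (k ℕ.+ k) ℤ.* (ifac k ℤ.* ifac k ℤ.* ifac k))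
      ≡⟨ rearrange₁ (-1024ℤ ℤ.^ k) (+ (k !)) (e ℤ.^ k) L (odd k) (odd (k ℕ.+ k)) (ifac k) ⟩
    -1024ℤ ℤ.^ k ℤ.* e ℤ.^ k ℤ.* (L ℤ.* odd k ℤ.* odd (k ℕ.+ k) ℤ.* + (k !)) ℤ.* (φ ℤ.* φ ℤ.* φ)
      ≈⟨ *-cong-≅ (*-cong-≅ powers ≅-refl) (*-cong-≅ (*-cong-≅ φ≅1 φ≅1) φ≅1) ⟩
    (+ 8) ℤ.^ k ℤ.* (L ℤ.* odd k ℤ.* odd (k ℕ.+ k) ℤ.* + (k !)) ℤ.* (1ℤ ℤ.* 1ℤ ℤ.* 1ℤ)
      ≡⟨ cong (λ z → z ℤ.* (L ℤ.* odd k ℤ.* odd (k ℕ.+ k) ℤ.* + (k !)) ℤ.* (1ℤ ℤ.* 1ℤ ℤ.* 1ℤ)) 8^k ⟩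
    w ℤ.* w ℤ.* w ℤ.* (L ℤ.* odd k ℤ.* odd (k ℕ.+ k) ℤ.* + (k !)) ℤ.* (1ℤ ℤ.* 1ℤ ℤ.* 1ℤ)
      ≡⟨ rearrange₂ w L (odd k) (odd (k ℕ.+ k)) (+ (k !)) ⟩
    L ℤ.* (odd (k ℕ.+ k) ℤ.* (w ℤ.* w ℤ.* (odd k ℤ.* (w ℤ.* + (k !)))))
      ≡⟨ cong (λ z → L ℤ.* (odd (k ℕ.+ k) ℤ.* (z ℤ.* (odd k ℤ.* (w ℤ.* + (k !)))))) (ℤ.^-distribˡ-+-* (+ 2) k k) ⟨
    L ℤ.* (odd (k ℕ.+ k) ℤ.* ((+ 2) ℤ.^ (k ℕ.+ k) ℤ.* (odd k ℤ.* (w ℤ.* + (k !)))))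
      ≡⟨ cong₂ ℤ._*_ (cong (ℤ._+ + 3) (ℤ.pos-* 20 k)) ([4k]! k) ⟨
    + (20 ℕ.* k ℕ.+ 3) ℤ.* + ((4 ℕ.* k) !) ∎)
    where
    open ≅-Reasoning (P ℤ.^ 4)
    w = (+ 2) ℤ.^ k
    L = + 20 ℤ.* + k ℤ.+ + 3
    φ = + (k !) ℤ.* ifac k
    φ≅1 : φ ≅ 1ℤ ⟨mod P ℤ.^ 4 ⟩
    φ≅1 = ≅-trans (≡⇒≅ (cong (ℤ._* ifac k) (sym (∏-suc≡! k)))) (factorial-inverse k k≤N)
    8≅ : -1024ℤ ℤ.* e ≅ + 8 ⟨mod P ℤ.^ 4 ⟩
    8≅ = combination₁ (ℤ.- + 8) (identity e) 128e≅-1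
      where
      identity : ∀ e → ℤ.- + 1024 ℤ.* e ℤ.+ ℤ.- + 8 ≡ ℤ.- + 8 ℤ.* (+ 128 ℤ.* e ℤ.+ ℤ.- -1ℤ)
      identity = solve-∀
    powers : -1024ℤ ℤ.^ k ℤ.* e ℤ.^ k ≅ (+ 8) ℤ.^ k ⟨mod P ℤ.^ 4 ⟩
    powers = ≅-trans (≡⇒≅ (sym (^-*-swap -1024ℤ e k))) (^-cong-≅ k 8≅)
    8^k : (+ 8) ℤ.^ k ≡ w ℤ.* w ℤ.* w
    8^k = trans (^-*-swap (+ 4) (+ 2) k) (cong (ℤ._* w) (^-*-swap (+ 2) (+ 2) k))
    rearrange₁ : ∀ u f E L o o′ i → u ℤ.* (f ℤ.* (f ℤ.* (f ℤ.* (f ℤ.* 1ℤ)))) ℤ.* (E ℤ.* L ℤ.* o ℤ.* o′ ℤ.* (i ℤ.* i ℤ.* i)) ≡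
      u ℤ.* E ℤ.* (L ℤ.* o ℤ.* o′ ℤ.* f) ℤ.* (f ℤ.* i ℤ.* (f ℤ.* i) ℤ.* (f ℤ.* i))
    rearrange₁ = solve-∀
    rearrange₂ : ∀ w L o o′ f → w ℤ.* w ℤ.* w ℤ.* (L ℤ.* o ℤ.* o′ ℤ.* f) ℤ.* (1ℤ ℤ.* 1ℤ ℤ.* 1ℤ) ≡
      L ℤ.* (o′ ℤ.* (w ℤ.* w ℤ.* (o ℤ.* (w ℤ.* f))))
    rearrange₂ = solve-∀

  summand-unit : ∀ k → k ≤ N → ¬ p ℕ.∣ ∣ -1024ℤ ℤ.^ k ℤ.* + ((k !) ℕ.^ 4) ∣
  summand-unit k k≤N = subst (λ d → ¬ p ℕ.∣ d)
    (sym (trans (ℤ.abs-* (-1024ℤ ℤ.^ k) (+ ((k !) ℕ.^ 4))) (cong (ℕ._* (k !) ℕ.^ 4) (abs-^ -1024ℤ k))))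
    (∤-* p-prime (1024 ℕ.^ k) ((k !) ℕ.^ 4) (∤-^ p-prime 1024 k (∤-^ p-prime 2 10 p∤2))
      (∤-^ p-prime (k !) 4 (∤-! p-prime k (s≤s (ℕ.≤-trans k≤N (ℕ.m≤m+n N N))))))

  ≅-pos : ∀ {x y} → x ≅ y ⟨mod P ℤ.^ 4 ⟩ → x ≅ y ⟨mod + (p ℕ.^ 4) ⟩
  ≅-pos {x} {y} = subst (x ≅ y ⟨mod_⟩) (sym (pos-^ p 4))

  summand↦ : ∀ k → k < suc N → _↦_⟨mod_⟩ p-prime (summand k) (S 0 k k) (+ (p ℕ.^ 4))
  summand↦ k (s≤s k≤N) = residue (-1024ℤ ℤ.^ k ℤ.* + ((k !) ℕ.^ 4)) (+ (20 ℕ.* k ℕ.+ 3) ℤ.* + ((4 ℕ.* k) !))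
    (summand-unit k k≤N) (summand-fraction k)
    (≅-pos (summand-reduced k k≤N))

  value : ℤ
  value = + p ℤ.* legendre -1ℤ p ℤ.* ((+ 2) ℤ.^ (N ℕ.+ N) ℤ.+ + 2 ℤ.- ((+ 2) ℤ.^ (N ℕ.+ N) ℤ.- 1ℤ) ℤ.^ 2)

  evaluation : partial-sum 0 N ≅ value ⟨mod + (p ℕ.^ 4) ⟩
  evaluation = ≅-pos (≅-trans integer-congruence (≡⇒≅ (begin
    P ℤ.* (-1ℤ ℤ.^ N ℤ.* (t ℤ.+ + 2 ℤ.+ ℤ.- ((t ℤ.+ ℤ.- 1ℤ) ℤ.* (t ℤ.+ ℤ.- 1ℤ))))
      ≡⟨ shape P (-1ℤ ℤ.^ N) t ⟩
    P ℤ.* -1ℤ ℤ.^ N ℤ.* (t ℤ.+ + 2 ℤ.- (t ℤ.- 1ℤ) ℤ.^ 2)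
      ≡⟨ cong₂ (λ s t → P ℤ.* s ℤ.* (t ℤ.+ + 2 ℤ.- (t ℤ.- 1ℤ) ℤ.^ 2)) legendre-1
           (trans (ℤ.^-distribˡ-+-* (+ 2) N N) (sym (^-*-swap (+ 2) (+ 2) N))) ⟨
    P ℤ.* legendre -1ℤ p ℤ.* ((+ 2) ℤ.^ (N ℕ.+ N) ℤ.+ + 2 ℤ.- ((+ 2) ℤ.^ (N ℕ.+ N) ℤ.- 1ℤ) ℤ.^ 2) ∎)))
    where
    open ≡-Reasoning
    shape : ∀ P σ t → P ℤ.* (σ ℤ.* (t ℤ.+ + 2 ℤ.+ ℤ.- ((t ℤ.+ ℤ.- 1ℤ) ℤ.* (t ℤ.+ ℤ.- 1ℤ)))) ≡
      P ℤ.* σ ℤ.* (t ℤ.+ + 2 ℤ.+ ℤ.- ((t ℤ.+ ℤ.- 1ℤ) ℤ.* ((t ℤ.+ ℤ.- 1ℤ) ℤ.* 1ℤ)))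
    shape = solve-∀

  -- The upper limit is a variable, so that matching on `refl` replaces (p - 1)/2 by N without
  -- rewriting inside the sum.
  supercongruence : ∀ n → n ≡ N → (∑[ k ≤ n ] summand (toℕ k)) ≡ fromℤ value [mod p ↑ 4 ]
  supercongruence n refl = ↦⇒≡[mod] p-prime {x = partial-sum 0 N} {y = value} 4 (↦-sum p-prime (suc N) summand↦) evaluation

theorem1p2 : ∀ (p : ℕ) → Prime p → 3 < p →
    (∑[ k ≤ (p ∸ 1) ℕ./ 2 ]
    (fromℤ (+ (20 ℕ.* toℕ k ℕ.+ 3)) ÷[ ℤ.- ((+ 2) ℤ.^ 10) ↑ toℕ k ]
    * multinomial₄ (toℕ k)))
    ≡ fromℤ (+ p ℤ.* legendre -1ℤ p
    ℤ.* ((+ 2) ℤ.^ (p ∸ 1) ℤ.+ + 2 ℤ.- ((+ 2) ℤ.^ (p ∸ 1) ℤ.- 1ℤ) ℤ.^ 2))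
    [mod p ↑ 4 ]
theorem1p2 p p-prime 3<p with parity p
... | inj₂ (N , refl) = supercongruence N p-prime 3<p ((N ℕ.+ N) ℕ./ 2)
  (trans (cong (ℕ._/ 2) (trans (cong (N ℕ.+_) (sym (ℕ.+-identityʳ N))) (ℕ.*-comm 2 N))) (m*n/n≡m N 2))
... | inj₁ (m , p≡m+m) with prime⇒irreducible p-prime (ℕ.divides m (trans p≡m+m (trans (cong (m ℕ.+_) (sym (ℕ.+-identityʳ m))) (ℕ.*-comm 2 m))))
...   | inj₁ ()
...   | inj₂ refl = contradiction 3<p λ { (s≤s (s≤s ())) }
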